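{- The reduction $\to_{\mathsf{se}}$ is sound: for all atomic flows $B,C$ with $B\to_{\mathsf{se}}C$ and every $\mathsf{SKS}$ derivation $\Phi$ with atomic flow $B$, there is an $\mathsf{SKS}$ derivation $\Psi$ with atomic flow $C$ and the same premiss and conclusion as $\Phi$.
   Context: $\mathsf{SKS}$: formulae from units $\mathsf f,\mathsf t$, atoms $a$ (involution $a\mapsto\bar a$), disjunction $[\alpha\vee\beta]$, conjunction $(\alpha\wedge\beta)$; inference steps rewrite $\xi\{\alpha\}$ to $\xi\{\beta\}$ in any context $\xi\{\ \}$ for instances of $\mathsf{ai}{\downarrow}\colon\mathsf t\to[a\vee\bar a]$ (interaction), $\mathsf{aw}{\downarrow}\colon\mathsf f\to a$ (weakening), $\mathsf{ac}{\downarrow}\colon[a\vee a]\to a$ (contraction), $\mathsf{ai}{\uparrow}\colon(a\wedge\bar a)\to\mathsf f$ (cointeraction), $\mathsf{aw}{\uparrow}\colon a\to\mathsf t$ (coweakening), $\mathsf{ac}{\uparrow}\colon a\to(a\wedge a)$ (cocontraction), switch $(\alpha\wedge[\beta\vee\gamma])\to[(\alpha\wedge\beta)\vee\gamma]$, medial $[(\alpha\wedge\beta)\vee(\gamma\wedge\delta)]\to([\alpha\vee\gamma]\wedge[\beta\vee\delta])$, and $=$ (commutativity/associativity of $\vee,\wedge$, $[\alpha\vee\mathsf f]=\alpha$, $(\alpha\wedge\mathsf t)=\alpha$, $[\mathsf t\vee\mathsf t]=\mathsf t$, $(\mathsf f\wedge\mathsf f)=\mathsf f$). A derivation is a sequence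 of formulae with consecutive ones related by an inference step. The atomic flow of a derivation is the directed acyclic graph whose edges are atom occurrences traced through the derivation (unchanged through contexts and through switch, medial and $=$), with one vertex for each instance of the six atomic structural rules, labelled accordingly, whose upper edges are the atom occurrences destroyed and lower edges those created (interaction: 0 upper, 2 lower; cointeraction: 2,0; weakening: 0,1; coweakening: 1,0; contraction: 2,1; cocontraction: 1,2); premiss atom occurrences are the flow's upper edges and conclusion occurrences its lower edges. Atomic flows in general are such graphs admitting a polarity assignment (equal polarities at (co)contractions, opposite at (co)interactions). A simple edge is an edge from an interaction vertex to a cointeraction vertex. Reduction $\to_{\mathsf{se}}$: let $B$ have a simple edge $\epsilon_1$ from an interaction $\nu$ (other lower edge $\epsilon_2$) to a cointeraction $\mu$ (other upper edge $\epsilon_3$). Let $A$ be $B$ with $\nu,\mu,\epsilon_1$ removed ($\epsilon_2$ becomes an upper and $\epsilon_3$ a lower edge of $A$); let $e_1,\dots,e_h$ be the upper edges and $e'_1,\dots,e'_k$ the lower edges of $B$. Take disjoint copies $\tilde A,\hat A$ of $A$. Then $B\to_{\mathsf{se}}C$ where $C$ consists of $\tilde A$, $\hat A$, a new weakening with lower edge $\tilde\epsilon_2$, a new coweakening with upper edge $\hat\epsilon_3$, the edges $\tilde\epsilon_3$ and $\hat\epsilon_2$ identified into one edge, for each $i\le h$ a new cocontraction with upper edge $e_i$ and lower edges $\tilde e_i,\hat e_i$, and for each $j\le k$ a new contraction with upper edges $\tilde e'_j,\hat e'_j$ and lower edge $e'_j$. -}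

module Defs where

open import Data.Nat using (ℕ; _<_)
open import Data.Bool using (Bool; true; false)
open import Data.Fin using (Fin)
open import Data.Unit using (⊤; tt)
open import Data.Empty using (⊥)
open import Data.Product using (Σ; ∃; _×_; _,_)
open import Data.Sum using (_⊎_; inj₁; inj₂; map₂)
open import Relation.Binary.PropositionalEquality using (_≡_; _≢_)
open import Function.Bundles using (_↔_; Inverse)

data Atom : Set where
  pos neg : ℕ → Atom

bar : Atom → Atom
bar (pos n) = neg n
bar (neg n) = pos n

infixr 6 _∨_
infixr 7 _∧_

data Formula : Set where
  𝖿 𝗍 : Formula
  atom : Atom → Formula
  _∨_ _∧_ : Formula → Formula → Formula

data Ctx : Set where
  □ : Ctx
  _∨◁_ : Ctx → Formula → Ctx
  _▷∨_ : Formula → Ctx → Ctx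
  _∧◁_ : Ctx → Formula → Ctx
  _▷∧_ : Formula → Ctx → Ctx

_⟦_⟧ : Ctx → Formula → Formula
□ ⟦ γ ⟧ = γ
(ξ ∨◁ β) ⟦ γ ⟧ = ξ ⟦ γ ⟧ ∨ β
(α ▷∨ ξ) ⟦ γ ⟧ = α ∨ ξ ⟦ γ ⟧
(ξ ∧◁ β) ⟦ γ ⟧ = ξ ⟦ γ ⟧ ∧ β
(α ▷∧ ξ) ⟦ γ ⟧ = α ∧ ξ ⟦ γ ⟧

data Occ : Formula → Set where
  here : ∀ {a} → Occ (atom a)
  ∨ˡ : ∀ {α β} → Occ α → Occ (α ∨ β)
  ∨ʳ : ∀ {α β} → Occ β → Occ (α ∨ β)
  ∧ˡ : ∀ {α β} → Occ α → Occ (α ∧ β)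
  ∧ʳ : ∀ {α β} → Occ β → Occ (α ∧ β)

inHole : ∀ {γ} (ξ : Ctx) → Occ γ → Occ (ξ ⟦ γ ⟧)
inHole □ o = o
inHole (ξ ∨◁ β) o = ∨ˡ (inHole ξ o)
inHole (α ▷∨ ξ) o = ∨ʳ (inHole ξ o)
inHole (ξ ∧◁ β) o = ∧ˡ (inHole ξ o)
inHole (α ▷∧ ξ) o = ∧ʳ (inHole ξ o)

-- an occurrence in ξ{γ} is either in the hole (an occurrence of γ) or
-- in the context, in which case it is the same occurrence of ξ{δ}
ctxOcc : ∀ {γ δ} (ξ : Ctx) → Occ (ξ ⟦ γ ⟧) → Occ γ ⊎ Occ (ξ ⟦ δ ⟧)
ctxOcc □ o = inj₁ o
ctxOcc (ξ ∨◁ β) (∨ˡ o) = map₂ ∨ˡ (ctxOcc ξ o)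
ctxOcc (ξ ∨◁ β) (∨ʳ o) = inj₂ (∨ʳ o)
ctxOcc (α ▷∨ ξ) (∨ˡ o) = inj₂ (∨ˡ o)
ctxOcc (α ▷∨ ξ) (∨ʳ o) = map₂ ∨ʳ (ctxOcc ξ o)
ctxOcc (ξ ∧◁ β) (∧ˡ o) = map₂ ∧ˡ (ctxOcc ξ o)
ctxOcc (ξ ∧◁ β) (∧ʳ o) = inj₂ (∧ʳ o)
ctxOcc (α ▷∧ ξ) (∧ˡ o) = inj₂ (∧ˡ o)
ctxOcc (α ▷∧ ξ) (∧ʳ o) = map₂ ∧ʳ (ctxOcc ξ o)

data Kind : Set where
  interaction weakening contraction : Kind
  cointeraction coweakening cocontraction : Kind

data ARule : Kind → Formula → Formula → Set where
  ai↓ : ∀ a → ARule interaction 𝗍 (atom a ∨ atom (bar a))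
  aw↓ : ∀ a → ARule weakening 𝖿 (atom a)
  ac↓ : ∀ a → ARule contraction (atom a ∨ atom a) (atom a)
  ai↑ : ∀ a → ARule cointeraction (atom a ∧ atom (bar a)) 𝖿
  aw↑ : ∀ a → ARule coweakening (atom a) 𝗍
  ac↑ : ∀ a → ARule cocontraction (atom a) (atom a ∧ atom a)

-- switch, medial, and the elementary instances (in both directions) of
-- the equations generating  =
data LRule : Formula → Formula → Set where
  switch : ∀ α β γ → LRule (α ∧ (β ∨ γ)) ((α ∧ β) ∨ γ)
  medial : ∀ α β γ δ → LRule ((α ∧ β) ∨ (γ ∧ δ)) ((α ∨ γ) ∧ (β ∨ δ))
  ∨-comm : ∀ α β → LRule (α ∨ β) (β ∨ α)
  ∧-comm : ∀ α β → LRule (α ∧ β) (β ∧ α)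
  ∨-assoc : ∀ α β γ → LRule ((α ∨ β) ∨ γ) (α ∨ (β ∨ γ))
  ∨-assoc⁻¹ : ∀ α β γ → LRule (α ∨ (β ∨ γ)) ((α ∨ β) ∨ γ)
  ∧-assoc : ∀ α β γ → LRule ((α ∧ β) ∧ γ) (α ∧ (β ∧ γ))
  ∧-assoc⁻¹ : ∀ α β γ → LRule (α ∧ (β ∧ γ)) ((α ∧ β) ∧ γ)
  ∨-unit : ∀ α → LRule (α ∨ 𝖿) α
  ∨-unit⁻¹ : ∀ α → LRule α (α ∨ 𝖿)
  ∧-unit : ∀ α → LRule (α ∧ 𝗍) α
  ∧-unit⁻¹ : ∀ α → LRule α (α ∧ 𝗍)
  𝗍∨𝗍 : LRule (𝗍 ∨ 𝗍) 𝗍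
  𝗍∨𝗍⁻¹ : LRule 𝗍 (𝗍 ∨ 𝗍)
  𝖿∧𝖿 : LRule (𝖿 ∧ 𝖿) 𝖿
  𝖿∧𝖿⁻¹ : LRule 𝖿 (𝖿 ∧ 𝖿)

lmap : ∀ {α β} → LRule α β → Occ α → Occ β
lmap (switch α β γ) (∧ˡ o) = ∨ˡ (∧ˡ o)
lmap (switch α β γ) (∧ʳ (∨ˡ o)) = ∨ˡ (∧ʳ o)
lmap (switch α β γ) (∧ʳ (∨ʳ o)) = ∨ʳ o
lmap (medial α β γ δ) (∨ˡ (∧ˡ o)) = ∧ˡ (∨ˡ o)
lmap (medial α β γ δ) (∨ˡ (∧ʳ o)) = ∧ʳ (∨ˡ o)
lmap (medial α β γ δ) (∨ʳ (∧ˡ o)) = ∧ˡ (∨ʳ o)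
lmap (medial α β γ δ) (∨ʳ (∧ʳ o)) = ∧ʳ (∨ʳ o)
lmap (∨-comm α β) (∨ˡ o) = ∨ʳ o
lmap (∨-comm α β) (∨ʳ o) = ∨ˡ o
lmap (∧-comm α β) (∧ˡ o) = ∧ʳ o
lmap (∧-comm α β) (∧ʳ o) = ∧ˡ o
lmap (∨-assoc α β γ) (∨ˡ (∨ˡ o)) = ∨ˡ o
lmap (∨-assoc α β γ) (∨ˡ (∨ʳ o)) = ∨ʳ (∨ˡ o)
lmap (∨-assoc α β γ) (∨ʳ o) = ∨ʳ (∨ʳ o)
lmap (∨-assoc⁻¹ α β γ) (∨ˡ o) = ∨ˡ (∨ˡ o)
lmap (∨-assoc⁻¹ α β γ) (∨ʳ (∨ˡ o)) = ∨ˡ (∨ʳ o)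
lmap (∨-assoc⁻¹ α β γ) (∨ʳ (∨ʳ o)) = ∨ʳ o
lmap (∧-assoc α β γ) (∧ˡ (∧ˡ o)) = ∧ˡ o
lmap (∧-assoc α β γ) (∧ˡ (∧ʳ o)) = ∧ʳ (∧ˡ o)
lmap (∧-assoc α β γ) (∧ʳ o) = ∧ʳ (∧ʳ o)
lmap (∧-assoc⁻¹ α β γ) (∧ˡ o) = ∧ˡ (∧ˡ o)
lmap (∧-assoc⁻¹ α β γ) (∧ʳ (∧ˡ o)) = ∧ˡ (∧ʳ o)
lmap (∧-assoc⁻¹ α β γ) (∧ʳ (∧ʳ o)) = ∧ʳ o
lmap (∨-unit α) (∨ˡ o) = o
lmap (∨-unit α) (∨ʳ ())
lmap (∨-unit⁻¹ α) o = ∨ˡ o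
lmap (∧-unit α) (∧ˡ o) = o
lmap (∧-unit α) (∧ʳ ())
lmap (∧-unit⁻¹ α) o = ∧ˡ o
lmap 𝗍∨𝗍 (∨ˡ ())
lmap 𝗍∨𝗍 (∨ʳ ())
lmap 𝗍∨𝗍⁻¹ ()
lmap 𝖿∧𝖿 (∧ˡ ())
lmap 𝖿∧𝖿 (∧ʳ ())
lmap 𝖿∧𝖿⁻¹ ()

data Step : Formula → Formula → Set where
  astep : ∀ {k γ δ} (ξ : Ctx) → ARule k γ δ → Step (ξ ⟦ γ ⟧) (ξ ⟦ δ ⟧)
  lstep : ∀ {γ δ} (ξ : Ctx) → LRule γ δ → Step (ξ ⟦ γ ⟧) (ξ ⟦ δ ⟧)

infixr 5 _∷_
data Deriv : Formula → Formula → Set where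
  [] : ∀ {α} → Deriv α α
  _∷_ : ∀ {α β γ} → Step α β → Deriv β γ → Deriv α γ

-- A (raw) flow graph whose upper edges are labelled by I and lower edges
-- by O.  Each edge has a source (an upper-boundary label, or the vertex
-- of which it is a lower edge) and a target (a lower-boundary label, or
-- the vertex of which it is an upper edge).
record Graph (I O : Set) : Set₁ where
  field
    Vtx : Set
    Edge : Set
    kind : Vtx → Kind
    src : Edge → I ⊎ Vtx
    tgt : Edge → O ⊎ Vtx

open Graph public

nUp nLow : Kind → ℕ
nUp interaction = 0
nUp weakening = 0
nUp contraction = 2
nUp cointeraction = 2
nUp coweakening = 1
nUp cocontraction = 1
nLow interaction = 2
nLow weakening = 1
nLow contraction = 1
nLow cointeraction = 0
nLow coweakening = 0
nLow cocontraction = 2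

PolRel : Kind → Bool → Bool → Set
PolRel interaction p q = p ≢ q
PolRel cointeraction p q = p ≢ q
PolRel weakening p q = p ≡ q
PolRel coweakening p q = p ≡ q
PolRel contraction p q = p ≡ q
PolRel cocontraction p q = p ≡ q

Incident : ∀ {I O} (G : Graph I O) → Edge G → Vtx G → Set
Incident G e v = src G e ≡ inj₂ v ⊎ tgt G e ≡ inj₂ v

record IsAtomicFlow {I O : Set} (G : Graph I O) : Set where
  field
    finite-Vtx : ∃ λ n → Fin n ↔ Vtx G
    finite-Edge : ∃ λ n → Fin n ↔ Edge G
    upper-bd : ∀ i → ⊤ ↔ Σ (Edge G) (λ e → src G e ≡ inj₁ i)
    lower-bd : ∀ j → ⊤ ↔ Σ (Edge G) (λ e → tgt G e ≡ inj₁ j)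
    upper-edges : ∀ v → Fin (nUp (kind G v)) ↔ Σ (Edge G) (λ e → tgt G e ≡ inj₂ v)
    lower-edges : ∀ v → Fin (nLow (kind G v)) ↔ Σ (Edge G) (λ e → src G e ≡ inj₂ v)
    acyclic : ∃ λ (rank : Vtx G → ℕ) →
      ∀ e v w → src G e ≡ inj₂ v → tgt G e ≡ inj₂ w → rank v < rank w
    polarity : ∃ λ (pol : Edge G → Bool) →
      ∀ v e e′ → Incident G e v → Incident G e′ v → e ≢ e′ →
        PolRel (kind G v) (pol e) (pol e′)

record _≅_ {I O : Set} (G H : Graph I O) : Set where
  field
    vtx-iso : Vtx G ↔ Vtx H
    edge-iso : Edge G ↔ Edge H
    kind-pres : ∀ v → kind H (Inverse.to vtx-iso v) ≡ kind G v
    src-pres : ∀ e → src H (Inverse.to edge-iso e) ≡ map₂ (Inverse.to vtx-iso) (src G e)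
    tgt-pres : ∀ e → tgt H (Inverse.to edge-iso e) ≡ map₂ (Inverse.to vtx-iso) (tgt G e)

-- The atomic flow of a derivation.
-- Vertices: the atomic-rule steps.  Edges: premiss occurrences, and the
-- occurrences created (lower edges) by each atomic-rule step; each edge
-- is traced downward until it is destroyed by a rule or reaches the
-- conclusion.

DVtx : ∀ {α β} → Deriv α β → Set
DVtx [] = ⊥
DVtx (astep ξ ρ ∷ Φ) = ⊤ ⊎ DVtx Φ
DVtx (lstep ξ ρ ∷ Φ) = DVtx Φ

dkind : ∀ {α β} (Φ : Deriv α β) → DVtx Φ → Kind
dkind [] ()
dkind (astep {k = k} ξ ρ ∷ Φ) (inj₁ _) = k
dkind (astep ξ ρ ∷ Φ) (inj₂ v) = dkind Φ v
dkind (lstep ξ ρ ∷ Φ) v = dkind Φ v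

Created : ∀ {α β} → Deriv α β → Set
Created [] = ⊥
Created (astep {δ = δ} ξ ρ ∷ Φ) = Occ δ ⊎ Created Φ
Created (lstep ξ ρ ∷ Φ) = Created Φ

trace : ∀ {α β} (Φ : Deriv α β) → Occ α → Occ β ⊎ DVtx Φ
trace [] o = inj₁ o
trace (astep ξ ρ ∷ Φ) o with ctxOcc ξ o
... | inj₁ _ = inj₂ (inj₁ tt)
... | inj₂ o′ = map₂ inj₂ (trace Φ o′)
trace (lstep ξ ρ ∷ Φ) o with ctxOcc ξ o
... | inj₁ h = trace Φ (inHole ξ (lmap ρ h))
... | inj₂ o′ = trace Φ o′

createdSrc : ∀ {α β} (Φ : Deriv α β) → Created Φ → DVtx Φ
createdSrc [] ()
createdSrc (astep ξ ρ ∷ Φ) (inj₁ _) = inj₁ tt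
createdSrc (astep ξ ρ ∷ Φ) (inj₂ c) = inj₂ (createdSrc Φ c)
createdSrc (lstep ξ ρ ∷ Φ) c = createdSrc Φ c

createdTgt : ∀ {α β} (Φ : Deriv α β) → Created Φ → Occ β ⊎ DVtx Φ
createdTgt [] ()
createdTgt (astep ξ ρ ∷ Φ) (inj₁ o) = map₂ inj₂ (trace Φ (inHole ξ o))
createdTgt (astep ξ ρ ∷ Φ) (inj₂ c) = map₂ inj₂ (createdTgt Φ c)
createdTgt (lstep ξ ρ ∷ Φ) c = createdTgt Φ c

flowOf : ∀ {α β} → Deriv α β → Graph (Occ α) (Occ β)
flowOf {α} Φ = record
  { Vtx = DVtx Φ
  ; Edge = Occ α ⊎ Created Φ
  ; kind = dkind Φ
  ; src = λ { (inj₁ o) → inj₁ o ; (inj₂ c) → inj₂ (createdSrc Φ c) }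
  ; tgt = λ { (inj₁ o) → trace Φ o ; (inj₂ c) → createdTgt Φ c }
  }

-- The reduction →se.
-- A : Graph (I ⊎ ⊤) (O ⊎ ⊤) plays the role of "B with ν, μ, ε₁ removed":
-- its extra upper edge (label inj₂ tt) is ε₂ and its extra lower edge
-- (label inj₂ tt) is ε₃.

data SimpleVtx : Set where
  ν μ : SimpleVtx

-- B = A together with interaction ν, cointeraction μ and the simple edge
-- ε₁ from ν to μ; ε₂ becomes a lower edge of ν and ε₃ an upper edge of μ.
withSimpleEdge : ∀ {I O} → Graph (I ⊎ ⊤) (O ⊎ ⊤) → Graph I O
withSimpleEdge {I} {O} A = record
  { Vtx = Vtx A ⊎ SimpleVtx
  ; Edge = Edge A ⊎ ⊤
  ; kind = λ { (inj₁ v) → kind A v ; (inj₂ ν) → interaction ; (inj₂ μ) → cointeraction }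
  ; src = λ { (inj₁ e) → s (src A e) ; (inj₂ _) → inj₂ (inj₂ ν) }
  ; tgt = λ { (inj₁ e) → t (tgt A e) ; (inj₂ _) → inj₂ (inj₂ μ) }
  }
  where
  s : (I ⊎ ⊤) ⊎ Vtx A → I ⊎ (Vtx A ⊎ SimpleVtx)
  s (inj₁ (inj₁ i)) = inj₁ i
  s (inj₁ (inj₂ _)) = inj₂ (inj₂ ν)
  s (inj₂ v) = inj₂ (inj₁ v)
  t : (O ⊎ ⊤) ⊎ Vtx A → O ⊎ (Vtx A ⊎ SimpleVtx)
  t (inj₁ (inj₁ j)) = inj₁ j
  t (inj₁ (inj₂ _)) = inj₂ (inj₂ μ)
  t (inj₂ v) = inj₂ (inj₁ v)

data CVtx (VA I O : Set) : Set where
  copy˜ copy^ : VA → CVtx VA I O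
  newW newCoW : CVtx VA I O
  coctr : I → CVtx VA I O
  ctr : O → CVtx VA I O

NotSlot : ∀ {X V : Set} → (X ⊎ ⊤) ⊎ V → Set
NotSlot (inj₁ (inj₂ _)) = ⊥
NotSlot _ = ⊤

-- edges of the reduct C: copies in Ã of all edges of A; copies in Â of
-- all edges of A except ε̂₂ (which is identified with ε̃₃, represented by
-- the edge edge˜ ε₃); the upper edges e_i and lower edges e′_j.
data CEdge {I O : Set} (A : Graph (I ⊎ ⊤) (O ⊎ ⊤)) : Set where
  edge˜ : Edge A → CEdge A
  edge^ : (e : Edge A) → NotSlot (src A e) → CEdge A
  upE : I → CEdge A
  lowE : O → CEdge A

-- the reduct C, given A and its edge ε₂ (the edge with source the new
-- upper boundary position inj₂ tt)
reduct : ∀ {I O} (A : Graph (I ⊎ ⊤) (O ⊎ ⊤)) → Edge A → Graph I O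
reduct {I} {O} A ε₂ = record
  { Vtx = CV
  ; Edge = CEdge A
  ; kind = k
  ; src = s
  ; tgt = t
  }
  where
  CV = CVtx (Vtx A) I O
  k : CV → Kind
  k (copy˜ v) = kind A v
  k (copy^ v) = kind A v
  k newW = weakening
  k newCoW = coweakening
  k (coctr _) = cocontraction
  k (ctr _) = contraction
  src˜ : (I ⊎ ⊤) ⊎ Vtx A → I ⊎ CV
  src˜ (inj₁ (inj₁ i)) = inj₂ (coctr i)
  src˜ (inj₁ (inj₂ _)) = inj₂ newW
  src˜ (inj₂ v) = inj₂ (copy˜ v)
  src^ : (x : (I ⊎ ⊤) ⊎ Vtx A) → NotSlot x → I ⊎ CV
  src^ (inj₁ (inj₁ i)) _ = inj₂ (coctr i)
  src^ (inj₁ (inj₂ _)) ()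
  src^ (inj₂ v) _ = inj₂ (copy^ v)
  tgt^ : (O ⊎ ⊤) ⊎ Vtx A → O ⊎ CV
  tgt^ (inj₁ (inj₁ j)) = inj₂ (ctr j)
  tgt^ (inj₁ (inj₂ _)) = inj₂ newCoW
  tgt^ (inj₂ v) = inj₂ (copy^ v)
  -- ε̃₃ is glued to ε̂₂, so it ends where ε̂₂ ends
  tgt˜ : (O ⊎ ⊤) ⊎ Vtx A → O ⊎ CV
  tgt˜ (inj₁ (inj₁ j)) = inj₂ (ctr j)
  tgt˜ (inj₁ (inj₂ _)) = tgt^ (tgt A ε₂)
  tgt˜ (inj₂ v) = inj₂ (copy˜ v)
  s : CEdge A → I ⊎ CV
  s (edge˜ e) = src˜ (src A e)
  s (edge^ e p) = src^ (src A e) p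
  s (upE i) = inj₁ i
  s (lowE j) = inj₂ (ctr j)
  t : CEdge A → O ⊎ CV
  t (edge˜ e) = tgt˜ (tgt A e)
  t (edge^ e _) = tgt^ (tgt A e)
  t (upE i) = inj₂ (coctr i)
  t (lowE j) = inj₁ j

record _→se_ {I O : Set} (B C : Graph I O) : Set₁ where
  field
    A : Graph (I ⊎ ⊤) (O ⊎ ⊤)
    ε₂ : Edge A
    ε₂-src : src A ε₂ ≡ inj₁ (inj₂ tt)
    B≅ : B ≅ withSimpleEdge A
    C≅ : C ≅ reduct A ε₂

{-# OPTIONS --safe #-}
module Submission where

-- Let a be the atom on the simple edge ε₁ and ā the atom on ε₂ and ε₃.
-- Substituting t for the occurrences of a on ε₁ turns ν into a
-- weakening, while at μ the formula (t ∧ ā) is left in place of f; ā is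
-- pulled out by switches, so that α derives [β ∨ ā] with flow Ã.
-- Substituting f instead turns μ into a coweakening, while ν can no longer
-- create ā, which is pushed in by switches from outside: (ā ∧ α) derives
-- β with flow Â.  These are composed as
--   α → (α ∧ α) → ([β ∨ ā] ∧ α) → [β ∨ (ā ∧ α)] → [β ∨ β] → β.
-- To control the flow, atom occurrences are labelled by flow edges: a
-- derivation whose steps respect the labels and use every vertex of G
-- exactly once has flow G.

open import Defs
open import Data.Nat using (ℕ; _<_; s<s)
open import Data.Nat.Properties using (0<1+n; <-irrefl)
open import Data.Fin using (Fin; zero; suc)
open import Data.Empty using (⊥; ⊥-elim)
open import Data.Unit using (⊤; tt)
open import Data.Product using (Σ; ∃; _×_; _,_; proj₁; proj₂)
open import Data.Sum using (_⊎_; inj₁; inj₂; map₂; [_,_])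
open import Data.Sum.Properties using (inj₁-injective; inj₂-injective)
open import Data.List using (List; []; _∷_; _++_; concatMap)
open import Data.List.Membership.Propositional using (_∈_; lose)
open import Data.List.Membership.Propositional.Properties using (∈-++⁺ˡ; ∈-++⁺ʳ; ∈-concatMap⁺)
open import Data.List.Relation.Unary.Any using (here; there)
open import Data.List.Relation.Unary.All as All using (All; []; _∷_)
import Data.List.Relation.Unary.All.Properties as All
open import Data.List.Relation.Unary.AllPairs as AllPairs using ([]; _∷_)
import Data.List.Relation.Unary.AllPairs.Properties as AllPairs
open import Data.List.Relation.Unary.Unique.Propositional using (Unique)
import Data.List.Relation.Unary.Unique.Propositional.Properties as Unique
open import Function.Base using (id; _∘_)
open import Function.Bundles using (_↔_; Inverse; mk↔ₛ′)
open import Function.Construct.Composition using (_↔-∘_)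
open import Function.Construct.Symmetry using (↔-sym)
open import Relation.Binary.PropositionalEquality
  using (_≡_; _≢_; refl; sym; trans; cong; subst)
open import Relation.Binary.PropositionalEquality.WithK using (≡-irrelevant)

-- Labelled formulae

-- Substituting a unit is sound because ε₁ meets no vertex besides ν and μ: between them its
-- occurrences only pass through contexts and linear rules, which are schematic in the formulae they
-- move. Each of the two steps at ν and μ becomes a (co)weakening in one copy and, in the other, a
-- linear step up to one stray ā: a surplus at μ, a deficit at ν. The surplus of the first copy pays
-- for the deficit of the second, so the middle of the composite holds a single occurrence of ā, and
-- this occurrence is the edge obtained by identifying ε̃₃ with ε̂₂.
--
-- The obstacle is bookkeeping: computing the flow of a long composite through `trace` would be
-- unwieldy. Labels make almost every condition local to one step, so that derivations compose and
-- lift into contexts without recomputing traces. What remains global is the labels at the boundary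
-- and the absence of repetitions and omissions in the list of used vertices.

at : ∀ {γ} → Occ γ → Atom
at {atom a} here = a
at (∨ˡ o) = at o
at (∨ʳ o) = at o
at (∧ˡ o) = at o
at (∧ʳ o) = at o

infixr 6 _∨ᴸ_
infixr 7 _∧ᴸ_

-- A tree rather than a function on occurrences, so that filling a context and applying a linear
-- rule compute and no extensionality is involved. `X` depends on the atom so that a label can carry
-- a proof about the atom it sits on.
data Labelling (X : Atom → Set) : Formula → Set where
  𝖿ᴸ : Labelling X 𝖿
  𝗍ᴸ : Labelling X 𝗍
  atomᴸ : ∀ {a} → X a → Labelling X (atom a)
  _∨ᴸ_ : ∀ {α β} → Labelling X α → Labelling X β → Labelling X (α ∨ β)
  _∧ᴸ_ : ∀ {α β} → Labelling X α → Labelling X β → Labelling X (α ∧ β)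

private variable
  X : Atom → Set
  α β γ δ : Formula

tabulate : (∀ o → X (at {γ} o)) → Labelling X γ
tabulate {γ = 𝖿} p = 𝖿ᴸ
tabulate {γ = 𝗍} p = 𝗍ᴸ
tabulate {γ = atom a} p = atomᴸ (p here)
tabulate {γ = γ ∨ δ} p = tabulate (p ∘ ∨ˡ) ∨ᴸ tabulate (p ∘ ∨ʳ)
tabulate {γ = γ ∧ δ} p = tabulate (p ∘ ∧ˡ) ∧ᴸ tabulate (p ∘ ∧ʳ)

hole : ∀ ξ → Labelling X (ξ ⟦ γ ⟧) → Labelling X γ
hole □ L = L
hole (ξ ∨◁ β) (L ∨ᴸ N) = hole ξ L
hole (α ▷∨ ξ) (N ∨ᴸ L) = hole ξ L
hole (ξ ∧◁ β) (L ∧ᴸ N) = hole ξ L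
hole (α ▷∧ ξ) (N ∧ᴸ L) = hole ξ L

plug : ∀ ξ → Labelling X (ξ ⟦ γ ⟧) → Labelling X δ → Labelling X (ξ ⟦ δ ⟧)
plug □ L M = M
plug (ξ ∨◁ β) (L ∨ᴸ N) M = plug ξ L M ∨ᴸ N
plug (α ▷∨ ξ) (N ∨ᴸ L) M = N ∨ᴸ plug ξ L M
plug (ξ ∧◁ β) (L ∧ᴸ N) M = plug ξ L M ∧ᴸ N
plug (α ▷∧ ξ) (N ∧ᴸ L) M = N ∧ᴸ plug ξ L M

act : LRule γ δ → Labelling X γ → Labelling X δ
act (switch _ _ _) (A ∧ᴸ (B ∨ᴸ C)) = (A ∧ᴸ B) ∨ᴸ C
act (medial _ _ _ _) ((A ∧ᴸ B) ∨ᴸ (C ∧ᴸ D)) = (A ∨ᴸ C) ∧ᴸ (B ∨ᴸ D)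
act (∨-comm _ _) (A ∨ᴸ B) = B ∨ᴸ A
act (∧-comm _ _) (A ∧ᴸ B) = B ∧ᴸ A
act (∨-assoc _ _ _) ((A ∨ᴸ B) ∨ᴸ C) = A ∨ᴸ (B ∨ᴸ C)
act (∨-assoc⁻¹ _ _ _) (A ∨ᴸ (B ∨ᴸ C)) = (A ∨ᴸ B) ∨ᴸ C
act (∧-assoc _ _ _) ((A ∧ᴸ B) ∧ᴸ C) = A ∧ᴸ (B ∧ᴸ C)
act (∧-assoc⁻¹ _ _ _) (A ∧ᴸ (B ∧ᴸ C)) = (A ∧ᴸ B) ∧ᴸ C
act (∨-unit _) (A ∨ᴸ 𝖿ᴸ) = A
act (∨-unit⁻¹ _) A = A ∨ᴸ 𝖿ᴸ
act (∧-unit _) (A ∧ᴸ 𝗍ᴸ) = A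
act (∧-unit⁻¹ _) A = A ∧ᴸ 𝗍ᴸ
act 𝗍∨𝗍 _ = 𝗍ᴸ
act 𝗍∨𝗍⁻¹ _ = 𝗍ᴸ ∨ᴸ 𝗍ᴸ
act 𝖿∧𝖿 _ = 𝖿ᴸ
act 𝖿∧𝖿⁻¹ _ = 𝖿ᴸ ∧ᴸ 𝖿ᴸ

-- Linear rules create no occurrence, so every label below such a step is inherited; with `act-!`
-- this transports facts about labels downwards.
lmap⁻¹ : (ρ : LRule γ δ) (o : Occ δ) → ∃ λ o′ → lmap ρ o′ ≡ o
lmap⁻¹ (switch _ _ _) (∨ˡ (∧ˡ o)) = ∧ˡ o , refl
lmap⁻¹ (switch _ _ _) (∨ˡ (∧ʳ o)) = ∧ʳ (∨ˡ o) , refl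
lmap⁻¹ (switch _ _ _) (∨ʳ o) = ∧ʳ (∨ʳ o) , refl
lmap⁻¹ (medial _ _ _ _) (∧ˡ (∨ˡ o)) = ∨ˡ (∧ˡ o) , refl
lmap⁻¹ (medial _ _ _ _) (∧ˡ (∨ʳ o)) = ∨ʳ (∧ˡ o) , refl
lmap⁻¹ (medial _ _ _ _) (∧ʳ (∨ˡ o)) = ∨ˡ (∧ʳ o) , refl
lmap⁻¹ (medial _ _ _ _) (∧ʳ (∨ʳ o)) = ∨ʳ (∧ʳ o) , refl
lmap⁻¹ (∨-comm _ _) (∨ˡ o) = ∨ʳ o , refl
lmap⁻¹ (∨-comm _ _) (∨ʳ o) = ∨ˡ o , refl
lmap⁻¹ (∧-comm _ _) (∧ˡ o) = ∧ʳ o , refl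
lmap⁻¹ (∧-comm _ _) (∧ʳ o) = ∧ˡ o , refl
lmap⁻¹ (∨-assoc _ _ _) (∨ˡ o) = ∨ˡ (∨ˡ o) , refl
lmap⁻¹ (∨-assoc _ _ _) (∨ʳ (∨ˡ o)) = ∨ˡ (∨ʳ o) , refl
lmap⁻¹ (∨-assoc _ _ _) (∨ʳ (∨ʳ o)) = ∨ʳ o , refl
lmap⁻¹ (∨-assoc⁻¹ _ _ _) (∨ˡ (∨ˡ o)) = ∨ˡ o , refl
lmap⁻¹ (∨-assoc⁻¹ _ _ _) (∨ˡ (∨ʳ o)) = ∨ʳ (∨ˡ o) , refl
lmap⁻¹ (∨-assoc⁻¹ _ _ _) (∨ʳ o) = ∨ʳ (∨ʳ o) , refl
lmap⁻¹ (∧-assoc _ _ _) (∧ˡ o) = ∧ˡ (∧ˡ o) , refl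
lmap⁻¹ (∧-assoc _ _ _) (∧ʳ (∧ˡ o)) = ∧ˡ (∧ʳ o) , refl
lmap⁻¹ (∧-assoc _ _ _) (∧ʳ (∧ʳ o)) = ∧ʳ o , refl
lmap⁻¹ (∧-assoc⁻¹ _ _ _) (∧ˡ (∧ˡ o)) = ∧ˡ o , refl
lmap⁻¹ (∧-assoc⁻¹ _ _ _) (∧ˡ (∧ʳ o)) = ∧ʳ (∧ˡ o) , refl
lmap⁻¹ (∧-assoc⁻¹ _ _ _) (∧ʳ o) = ∧ʳ (∧ʳ o) , refl
lmap⁻¹ (∨-unit _) o = ∨ˡ o , refl
lmap⁻¹ (∨-unit⁻¹ _) (∨ˡ o) = o , refl
lmap⁻¹ (∧-unit _) o = ∧ˡ o , refl
lmap⁻¹ (∧-unit⁻¹ _) (∧ˡ o) = o , refl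
lmap⁻¹ 𝗍∨𝗍⁻¹ (∨ˡ ())
lmap⁻¹ 𝗍∨𝗍⁻¹ (∨ʳ ())
lmap⁻¹ 𝖿∧𝖿⁻¹ (∧ˡ ())
lmap⁻¹ 𝖿∧𝖿⁻¹ (∧ʳ ())

ctxOcc-inHole : ∀ ξ (h : Occ γ) → ctxOcc {γ} {δ} ξ (inHole ξ h) ≡ inj₁ h
ctxOcc-inHole □ h = refl
ctxOcc-inHole {δ = δ} (ξ ∨◁ β) h rewrite ctxOcc-inHole {δ = δ} ξ h = refl
ctxOcc-inHole {δ = δ} (α ▷∨ ξ) h rewrite ctxOcc-inHole {δ = δ} ξ h = refl
ctxOcc-inHole {δ = δ} (ξ ∧◁ β) h rewrite ctxOcc-inHole {δ = δ} ξ h = refl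
ctxOcc-inHole {δ = δ} (α ▷∧ ξ) h rewrite ctxOcc-inHole {δ = δ} ξ h = refl

ctxOcc-origin : ∀ ξ (o : Occ (ξ ⟦ δ ⟧)) →
  (∃ λ h → inHole ξ h ≡ o) ⊎ (∃ λ o′ → ctxOcc {γ} {δ} ξ o′ ≡ inj₂ o)
ctxOcc-origin □ o = inj₁ (o , refl)
ctxOcc-origin {γ = γ} (ξ ∨◁ β) (∨ˡ o) with ctxOcc-origin {γ = γ} ξ o
... | inj₁ (h , refl) = inj₁ (h , refl)
... | inj₂ (o′ , eq) = inj₂ (∨ˡ o′ , cong (map₂ ∨ˡ) eq)
ctxOcc-origin (ξ ∨◁ β) (∨ʳ o) = inj₂ (∨ʳ o , refl)
ctxOcc-origin (α ▷∨ ξ) (∨ˡ o) = inj₂ (∨ˡ o , refl)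
ctxOcc-origin {γ = γ} (α ▷∨ ξ) (∨ʳ o) with ctxOcc-origin {γ = γ} ξ o
... | inj₁ (h , refl) = inj₁ (h , refl)
... | inj₂ (o′ , eq) = inj₂ (∨ʳ o′ , cong (map₂ ∨ʳ) eq)
ctxOcc-origin {γ = γ} (ξ ∧◁ β) (∧ˡ o) with ctxOcc-origin {γ = γ} ξ o
... | inj₁ (h , refl) = inj₁ (h , refl)
... | inj₂ (o′ , eq) = inj₂ (∧ˡ o′ , cong (map₂ ∧ˡ) eq)
ctxOcc-origin (ξ ∧◁ β) (∧ʳ o) = inj₂ (∧ʳ o , refl)
ctxOcc-origin (α ▷∧ ξ) (∧ˡ o) = inj₂ (∧ˡ o , refl)
ctxOcc-origin {γ = γ} (α ▷∧ ξ) (∧ʳ o) with ctxOcc-origin {γ = γ} ξ o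
... | inj₁ (h , refl) = inj₁ (h , refl)
... | inj₂ (o′ , eq) = inj₂ (∧ʳ o′ , cong (map₂ ∧ʳ) eq)

module Labels {X : Atom → Set} {E : Set} (edge : ∀ a → X a → E) where

  infix 8 _!_
  _!_ : Labelling X γ → Occ γ → E
  atomᴸ {a} x ! here = edge a x
  (L ∨ᴸ N) ! ∨ˡ o = L ! o
  (L ∨ᴸ N) ! ∨ʳ o = N ! o
  (L ∧ᴸ N) ! ∧ˡ o = L ! o
  (L ∧ᴸ N) ! ∧ʳ o = N ! o

  tabulate-! : (p : ∀ o → X (at {γ} o)) → ∀ o → tabulate p ! o ≡ edge _ (p o)
  tabulate-! p here = refl
  tabulate-! p (∨ˡ o) = tabulate-! (p ∘ ∨ˡ) o
  tabulate-! p (∨ʳ o) = tabulate-! (p ∘ ∨ʳ) o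
  tabulate-! p (∧ˡ o) = tabulate-! (p ∘ ∧ˡ) o
  tabulate-! p (∧ʳ o) = tabulate-! (p ∘ ∧ʳ) o

  plug-! : ∀ ξ (L : Labelling X (ξ ⟦ γ ⟧)) (M : Labelling X δ) h →
    plug ξ L M ! inHole ξ h ≡ M ! h
  plug-! □ L M h = refl
  plug-! (ξ ∨◁ β) (L ∨ᴸ N) M h = plug-! ξ L M h
  plug-! (α ▷∨ ξ) (N ∨ᴸ L) M h = plug-! ξ L M h
  plug-! (ξ ∧◁ β) (L ∧ᴸ N) M h = plug-! ξ L M h
  plug-! (α ▷∧ ξ) (N ∧ᴸ L) M h = plug-! ξ L M h

  hole-! : ∀ ξ (L : Labelling X (ξ ⟦ γ ⟧)) h → hole ξ L ! h ≡ L ! inHole ξ h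
  hole-! □ L h = refl
  hole-! (ξ ∨◁ β) (L ∨ᴸ N) h = hole-! ξ L h
  hole-! (α ▷∨ ξ) (N ∨ᴸ L) h = hole-! ξ L h
  hole-! (ξ ∧◁ β) (L ∧ᴸ N) h = hole-! ξ L h
  hole-! (α ▷∧ ξ) (N ∧ᴸ L) h = hole-! ξ L h

  -- Stated along the case split that `trace` makes, so that a traced occurrence is seen to keep its
  -- label in either branch.
  ctxOcc-! : ∀ ξ (L : Labelling X (ξ ⟦ γ ⟧)) (M : Labelling X δ) o →
    [ (λ h → hole ξ L ! h ≡ L ! o) , (λ o′ → plug ξ L M ! o′ ≡ L ! o) ] (ctxOcc {γ} {δ} ξ o)
  ctxOcc-! □ L M o = refl
  ctxOcc-! {δ = δ} (ξ ∨◁ β) (L ∨ᴸ N) M (∨ˡ o) with ctxOcc {δ = δ} ξ o | ctxOcc-! ξ L M o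
  ... | inj₁ _ | eq = eq
  ... | inj₂ _ | eq = eq
  ctxOcc-! (ξ ∨◁ β) (L ∨ᴸ N) M (∨ʳ o) = refl
  ctxOcc-! (α ▷∨ ξ) (N ∨ᴸ L) M (∨ˡ o) = refl
  ctxOcc-! {δ = δ} (α ▷∨ ξ) (N ∨ᴸ L) M (∨ʳ o) with ctxOcc {δ = δ} ξ o | ctxOcc-! ξ L M o
  ... | inj₁ _ | eq = eq
  ... | inj₂ _ | eq = eq
  ctxOcc-! {δ = δ} (ξ ∧◁ β) (L ∧ᴸ N) M (∧ˡ o) with ctxOcc {δ = δ} ξ o | ctxOcc-! ξ L M o
  ... | inj₁ _ | eq = eq
  ... | inj₂ _ | eq = eq
  ctxOcc-! (ξ ∧◁ β) (L ∧ᴸ N) M (∧ʳ o) = refl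
  ctxOcc-! (α ▷∧ ξ) (N ∧ᴸ L) M (∧ˡ o) = refl
  ctxOcc-! {δ = δ} (α ▷∧ ξ) (N ∧ᴸ L) M (∧ʳ o) with ctxOcc {δ = δ} ξ o | ctxOcc-! ξ L M o
  ... | inj₁ _ | eq = eq
  ... | inj₂ _ | eq = eq

  act-! : (ρ : LRule γ δ) (L : Labelling X γ) → ∀ o → act ρ L ! lmap ρ o ≡ L ! o
  act-! (switch _ _ _) (_ ∧ᴸ (_ ∨ᴸ _)) (∧ˡ o) = refl
  act-! (switch _ _ _) (_ ∧ᴸ (_ ∨ᴸ _)) (∧ʳ (∨ˡ o)) = refl
  act-! (switch _ _ _) (_ ∧ᴸ (_ ∨ᴸ _)) (∧ʳ (∨ʳ o)) = refl
  act-! (medial _ _ _ _) ((_ ∧ᴸ _) ∨ᴸ (_ ∧ᴸ _)) (∨ˡ (∧ˡ o)) = refl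
  act-! (medial _ _ _ _) ((_ ∧ᴸ _) ∨ᴸ (_ ∧ᴸ _)) (∨ˡ (∧ʳ o)) = refl
  act-! (medial _ _ _ _) ((_ ∧ᴸ _) ∨ᴸ (_ ∧ᴸ _)) (∨ʳ (∧ˡ o)) = refl
  act-! (medial _ _ _ _) ((_ ∧ᴸ _) ∨ᴸ (_ ∧ᴸ _)) (∨ʳ (∧ʳ o)) = refl
  act-! (∨-comm _ _) (_ ∨ᴸ _) (∨ˡ o) = refl
  act-! (∨-comm _ _) (_ ∨ᴸ _) (∨ʳ o) = refl
  act-! (∧-comm _ _) (_ ∧ᴸ _) (∧ˡ o) = refl
  act-! (∧-comm _ _) (_ ∧ᴸ _) (∧ʳ o) = refl
  act-! (∨-assoc _ _ _) ((_ ∨ᴸ _) ∨ᴸ _) (∨ˡ (∨ˡ o)) = refl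
  act-! (∨-assoc _ _ _) ((_ ∨ᴸ _) ∨ᴸ _) (∨ˡ (∨ʳ o)) = refl
  act-! (∨-assoc _ _ _) ((_ ∨ᴸ _) ∨ᴸ _) (∨ʳ o) = refl
  act-! (∨-assoc⁻¹ _ _ _) (_ ∨ᴸ (_ ∨ᴸ _)) (∨ˡ o) = refl
  act-! (∨-assoc⁻¹ _ _ _) (_ ∨ᴸ (_ ∨ᴸ _)) (∨ʳ (∨ˡ o)) = refl
  act-! (∨-assoc⁻¹ _ _ _) (_ ∨ᴸ (_ ∨ᴸ _)) (∨ʳ (∨ʳ o)) = refl
  act-! (∧-assoc _ _ _) ((_ ∧ᴸ _) ∧ᴸ _) (∧ˡ (∧ˡ o)) = refl
  act-! (∧-assoc _ _ _) ((_ ∧ᴸ _) ∧ᴸ _) (∧ˡ (∧ʳ o)) = refl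
  act-! (∧-assoc _ _ _) ((_ ∧ᴸ _) ∧ᴸ _) (∧ʳ o) = refl
  act-! (∧-assoc⁻¹ _ _ _) (_ ∧ᴸ (_ ∧ᴸ _)) (∧ˡ o) = refl
  act-! (∧-assoc⁻¹ _ _ _) (_ ∧ᴸ (_ ∧ᴸ _)) (∧ʳ (∧ˡ o)) = refl
  act-! (∧-assoc⁻¹ _ _ _) (_ ∧ᴸ (_ ∧ᴸ _)) (∧ʳ (∧ʳ o)) = refl
  act-! (∨-unit _) (_ ∨ᴸ 𝖿ᴸ) (∨ˡ o) = refl
  act-! (∨-unit⁻¹ _) _ o = refl
  act-! (∧-unit _) (_ ∧ᴸ 𝗍ᴸ) (∧ˡ o) = refl
  act-! (∧-unit⁻¹ _) _ o = refl
  act-! 𝗍∨𝗍 _ (∨ˡ ())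
  act-! 𝗍∨𝗍 _ (∨ʳ ())
  act-! 𝖿∧𝖿 _ (∧ˡ ())
  act-! 𝖿∧𝖿 _ (∧ʳ ())

-- Labelled derivations

module LabelledDerivations {I O : Set} (G : Graph I O) {X : Atom → Set} (edge : ∀ a → X a → Edge G) where

  open Labels edge public

  -- Weaker than `Creates` on purpose: every edge of the flow of a derivation is indexed by its
  -- upper end, a premiss occurrence or a creating step. Exhaustiveness and distinctness therefore
  -- matter for sources only; for targets, incidence is enough.
  Consumes : Labelling X γ → Vtx G → Set
  Consumes N v = ∀ o → tgt G (N ! o) ≡ inj₂ v

  record Creates (M : Labelling X δ) (v : Vtx G) : Set where
    constructor creates
    field
      source : ∀ o → src G (M ! o) ≡ inj₂ v
      distinct : ∀ o o′ → M ! o ≡ M ! o′ → o ≡ o′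
      complete : ∀ e → src G e ≡ inj₂ v → ∃ λ o → M ! o ≡ e

  open Creates public

  -- The index lists the vertices used by the atomic steps, in order. Its distinctness is not built
  -- in, since composition would not preserve it; it is checked once, for the final list.
  data LDeriv : Labelling X α → Labelling X β → List (Vtx G) → Set where
    [] : {L : Labelling X α} → LDeriv L L []
    astep : ∀ {k us} ξ (ρ : ARule k γ δ) {L : Labelling X (ξ ⟦ γ ⟧)} {L′ : Labelling X β}
      (M : Labelling X δ) v → kind G v ≡ k → Consumes (hole ξ L) v → Creates M v →
      LDeriv (plug ξ L M) L′ us → LDeriv L L′ (v ∷ us)
    lstep : ∀ {us} ξ (ρ : LRule γ δ) {L : Labelling X (ξ ⟦ γ ⟧)} {L′ : Labelling X β} →
      LDeriv (plug ξ L (act ρ (hole ξ L))) L′ us → LDeriv L L′ us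

  private variable
    us vs : List (Vtx G)
    L : Labelling X α
    M : Labelling X β
    N : Labelling X γ

  infixr 5 _⨾_
  _⨾_ : LDeriv L M us → LDeriv M N vs → LDeriv L N (us ++ vs)
  [] ⨾ E = E
  astep ξ ρ M v k c d D ⨾ E = astep ξ ρ M v k c d (D ⨾ E)
  lstep ξ ρ D ⨾ E = lstep ξ ρ (D ⨾ E)

  ∨-liftˡ : LDeriv L M us → LDeriv (L ∨ᴸ N) (M ∨ᴸ N) us
  ∨-liftˡ [] = []
  ∨-liftˡ (astep ξ ρ M v k c d D) = astep (ξ ∨◁ _) ρ M v k c d (∨-liftˡ D)
  ∨-liftˡ (lstep ξ ρ D) = lstep (ξ ∨◁ _) ρ (∨-liftˡ D)

  ∨-liftʳ : LDeriv L M us → LDeriv (N ∨ᴸ L) (N ∨ᴸ M) us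
  ∨-liftʳ [] = []
  ∨-liftʳ (astep ξ ρ M v k c d D) = astep (_ ▷∨ ξ) ρ M v k c d (∨-liftʳ D)
  ∨-liftʳ (lstep ξ ρ D) = lstep (_ ▷∨ ξ) ρ (∨-liftʳ D)

  ∧-liftˡ : LDeriv L M us → LDeriv (L ∧ᴸ N) (M ∧ᴸ N) us
  ∧-liftˡ [] = []
  ∧-liftˡ (astep ξ ρ M v k c d D) = astep (ξ ∧◁ _) ρ M v k c d (∧-liftˡ D)
  ∧-liftˡ (lstep ξ ρ D) = lstep (ξ ∧◁ _) ρ (∧-liftˡ D)

  ∧-liftʳ : LDeriv L M us → LDeriv (N ∧ᴸ L) (N ∧ᴸ M) us
  ∧-liftʳ [] = []
  ∧-liftʳ (astep ξ ρ M v k c d D) = astep (_ ▷∧ ξ) ρ M v k c d (∧-liftʳ D)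
  ∧-liftʳ (lstep ξ ρ D) = lstep (_ ▷∧ ξ) ρ (∧-liftʳ D)

  rule : (ρ : LRule α β) → LDeriv L (act ρ L) []
  rule ρ = lstep □ ρ []

  erase : {L : Labelling X α} {M : Labelling X β} → LDeriv L M us → Deriv α β
  erase [] = []
  erase (astep ξ ρ _ _ _ _ _ D) = astep ξ ρ ∷ erase D
  erase (lstep ξ ρ D) = lstep ξ ρ ∷ erase D

  vertex : (D : LDeriv L M us) → DVtx (erase D) → Vtx G
  vertex (astep _ _ _ v _ _ _ D) (inj₁ _) = v
  vertex (astep _ _ _ _ _ _ _ D) (inj₂ x) = vertex D x
  vertex (lstep _ _ D) x = vertex D x

  created : (D : LDeriv L M us) → Created (erase D) → Edge G
  created (astep _ _ M _ _ _ _ D) (inj₁ o) = M ! o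
  created (astep _ _ _ _ _ _ _ D) (inj₂ c) = created D c
  created (lstep _ _ D) c = created D c

  vertex-kind : (D : LDeriv L M us) → ∀ x → kind G (vertex D x) ≡ dkind (erase D) x
  vertex-kind (astep _ _ _ _ k _ _ D) (inj₁ _) = k
  vertex-kind (astep _ _ _ _ _ _ _ D) (inj₂ x) = vertex-kind D x
  vertex-kind (lstep _ _ D) x = vertex-kind D x

  vertex-∈ : (D : LDeriv L M us) → ∀ x → vertex D x ∈ us
  vertex-∈ (astep _ _ _ _ _ _ _ D) (inj₁ _) = here refl
  vertex-∈ (astep _ _ _ _ _ _ _ D) (inj₂ x) = there (vertex-∈ D x)
  vertex-∈ (lstep _ _ D) x = vertex-∈ D x

  vertex-surjective : (D : LDeriv L M us) → ∀ {v} → v ∈ us → ∃ λ x → vertex D x ≡ v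
  vertex-surjective (astep _ _ _ _ _ _ _ D) (here eq) = inj₁ tt , sym eq
  vertex-surjective (astep _ _ _ _ _ _ _ D) (there p) with vertex-surjective D p
  ... | x , eq = inj₂ x , eq
  vertex-surjective (lstep _ _ D) p = vertex-surjective D p

  vertex-injective : (D : LDeriv L M us) → Unique us → ∀ x y → vertex D x ≡ vertex D y → x ≡ y
  vertex-injective (astep _ _ _ _ _ _ _ D) u (inj₁ _) (inj₁ _) eq = refl
  vertex-injective (astep _ _ _ _ _ _ _ D) (v∉ ∷ u) (inj₁ _) (inj₂ y) eq = ⊥-elim (All.lookup v∉ (vertex-∈ D y) eq)
  vertex-injective (astep _ _ _ _ _ _ _ D) (v∉ ∷ u) (inj₂ x) (inj₁ _) eq = ⊥-elim (All.lookup v∉ (vertex-∈ D x) (sym eq))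
  vertex-injective (astep _ _ _ _ _ _ _ D) (_ ∷ u) (inj₂ x) (inj₂ y) eq = cong inj₂ (vertex-injective D u x y eq)
  vertex-injective (lstep _ _ D) u x y eq = vertex-injective D u x y eq

  created-src : (D : LDeriv L M us) → ∀ c → src G (created D c) ≡ inj₂ (vertex D (createdSrc (erase D) c))
  created-src (astep _ _ _ _ _ _ d D) (inj₁ o) = source d o
  created-src (astep _ _ _ _ _ _ _ D) (inj₂ c) = created-src D c
  created-src (lstep _ _ D) c = created-src D c

  created-complete : (D : LDeriv L M us) → ∀ x e → src G e ≡ inj₂ (vertex D x) → ∃ λ c → created D c ≡ e
  created-complete (astep _ _ _ _ _ _ d D) (inj₁ _) e eq with complete d e eq
  ... | o , p = inj₁ o , p
  created-complete (astep _ _ _ _ _ _ _ D) (inj₂ x) e eq with created-complete D x e eq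
  ... | c , p = inj₂ c , p
  created-complete (lstep _ _ D) x e eq = created-complete D x e eq

  -- Within one step the labels are distinct by `Creates`; across steps their sources differ, since
  -- no vertex is used twice.
  created-injective : (D : LDeriv L M us) → Unique us → ∀ c c′ → created D c ≡ created D c′ → c ≡ c′
  created-injective (astep _ _ _ _ _ _ d D) u (inj₁ o) (inj₁ o′) eq = cong inj₁ (distinct d o o′ eq)
  created-injective (astep _ _ _ _ _ _ d D) (v∉ ∷ u) (inj₁ o) (inj₂ c) eq = ⊥-elim (All.lookup v∉ (vertex-∈ D _)
    (inj₂-injective (trans (sym (source d o)) (trans (cong (src G) eq) (created-src D c)))))
  created-injective (astep _ _ _ _ _ _ d D) (v∉ ∷ u) (inj₂ c) (inj₁ o) eq = ⊥-elim (All.lookup v∉ (vertex-∈ D _)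
    (inj₂-injective (trans (sym (source d o)) (trans (cong (src G) (sym eq)) (created-src D c)))))
  created-injective (astep _ _ _ _ _ _ d D) (_ ∷ u) (inj₂ c) (inj₂ c′) eq = cong inj₂ (created-injective D u c c′ eq)
  created-injective (lstep _ _ D) u c c′ eq = created-injective D u c c′ eq

-- Isomorphisms of flow graphs

map₂-map₂ : ∀ {A B C D : Set} {f : C → D} {g : B → C} (z : A ⊎ B) → map₂ f (map₂ g z) ≡ map₂ (f ∘ g) z
map₂-map₂ (inj₁ _) = refl
map₂-map₂ (inj₂ _) = refl

≅-sym : ∀ {I O} {G H : Graph I O} → G ≅ H → H ≅ G
≅-sym {G = G} {H} i = record
  { vtx-iso = ↔-sym vtx-iso
  ; edge-iso = ↔-sym edge-iso
  ; kind-pres = λ v → trans (sym (kind-pres (Inverse.from vtx-iso v))) (cong (kind H) (Inverse.strictlyInverseˡ vtx-iso v))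
  ; src-pres = λ e → back (src G _) (trans (sym (src-pres _)) (cong (src H) (Inverse.strictlyInverseˡ edge-iso e)))
  ; tgt-pres = λ e → back (tgt G _) (trans (sym (tgt-pres _)) (cong (tgt H) (Inverse.strictlyInverseˡ edge-iso e)))
  }
  where
  open _≅_ i
  back : ∀ {A : Set} (z : A ⊎ Vtx G) {w} → map₂ (Inverse.to vtx-iso) z ≡ w → z ≡ map₂ (Inverse.from vtx-iso) w
  back (inj₁ _) refl = refl
  back (inj₂ v) refl = cong inj₂ (sym (Inverse.strictlyInverseʳ vtx-iso v))

≅-trans : ∀ {I O} {G H K : Graph I O} → G ≅ H → H ≅ K → G ≅ K
≅-trans {G = G} i j = record
  { vtx-iso = J.vtx-iso ↔-∘ I.vtx-iso
  ; edge-iso = J.edge-iso ↔-∘ I.edge-iso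
  ; kind-pres = λ v → trans (J.kind-pres _) (I.kind-pres v)
  ; src-pres = λ e → trans (J.src-pres _) (trans (cong (map₂ _) (I.src-pres e)) (map₂-map₂ (src G e)))
  ; tgt-pres = λ e → trans (J.tgt-pres _) (trans (cong (map₂ _) (I.tgt-pres e)) (map₂-map₂ (tgt G e)))
  }
  where
  module I = _≅_ i
  module J = _≅_ j

bijection : ∀ {A B : Set} (f : A → B) → (∀ x y → f x ≡ f y → x ≡ y) → (∀ y → ∃ λ x → f x ≡ y) → A ↔ B
bijection f inj sur = mk↔ₛ′ f (proj₁ ∘ sur) (proj₂ ∘ sur) (λ x → inj _ _ (proj₂ (sur (f x))))

-- Labelled derivations realise the graph that labels them

module Realisation {I : Set} {β} (G : Graph I (Occ β)) {X : Atom → Set} (edge : ∀ a → X a → Edge G) where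

  open LabelledDerivations G edge

  module _ {L′ : Labelling X β} (end : ∀ o → tgt G (L′ ! o) ≡ inj₁ o) where

    -- A label does not change while its occurrence is traced, so its target can be read where the
    -- trace stops: from `Consumes` at the destroying step, from `end` at the conclusion.
    traced-tgt : ∀ {us} {L : Labelling X α} (D : LDeriv L L′ us) →
      ∀ o → tgt G (L ! o) ≡ map₂ (vertex D) (trace (erase D) o)
    traced-tgt [] o = end o
    traced-tgt (astep {δ = δ} ξ ρ {L} M v k c d D) o with ctxOcc {δ = δ} ξ o | ctxOcc-! ξ L M o
    ... | inj₁ h | eq = trans (cong (tgt G) (sym eq)) (c h)
    ... | inj₂ o′ | eq = trans (cong (tgt G) (sym eq)) (trans (traced-tgt D o′) (sym (map₂-map₂ (trace (erase D) o′))))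
    traced-tgt (lstep {δ = δ} ξ ρ {L} D) o with ctxOcc {δ = δ} ξ o | ctxOcc-! ξ L (act ρ (hole ξ L)) o
    ... | inj₁ h | eq =
      trans (cong (tgt G) (sym (trans (plug-! ξ L _ _) (trans (act-! ρ _ h) eq)))) (traced-tgt D (inHole ξ (lmap ρ h)))
    ... | inj₂ o′ | eq = trans (cong (tgt G) (sym eq)) (traced-tgt D o′)

    created-tgt : ∀ {us} {L : Labelling X α} (D : LDeriv L L′ us) →
      ∀ c → tgt G (created D c) ≡ map₂ (vertex D) (createdTgt (erase D) c)
    created-tgt (astep ξ ρ {L} M v k c d D) (inj₁ o) =
      trans (cong (tgt G) (sym (plug-! ξ L M o)))
        (trans (traced-tgt D (inHole ξ o)) (sym (map₂-map₂ (trace (erase D) (inHole ξ o)))))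
    created-tgt (astep ξ ρ M v k c d D) (inj₂ c′) = trans (created-tgt D c′) (sym (map₂-map₂ (createdTgt (erase D) c′)))
    created-tgt (lstep ξ ρ D) c = created-tgt D c

-- Edges are matched by source: an upper edge of `G` is a label of the premiss, and an edge leaving
-- a vertex is created by the step that uses this vertex, which exists because the list is total.
flowOf-erase : ∀ {α β} (G : Graph (Occ α) (Occ β)) {X : Atom → Set} (edge : ∀ a → X a → Edge G) →
  let open LabelledDerivations G edge in
  ∀ {us L L′} (D : LDeriv L L′ us) →
  (∀ o → src G (L ! o) ≡ inj₁ o) → (∀ e o → src G e ≡ inj₁ o → L ! o ≡ e) →
  (∀ o → tgt G (L′ ! o) ≡ inj₁ o) →
  Unique us → (∀ v → v ∈ us) →
  flowOf (erase D) ≅ G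
flowOf-erase {α} G edge {L = L} D start start! end unique total = record
  { vtx-iso = bijection (vertex D) (vertex-injective D unique) (λ v → vertex-surjective D (total v))
  ; edge-iso = bijection toEdge toEdge-injective toEdge-surjective
  ; kind-pres = vertex-kind D
  ; src-pres = λ { (inj₁ o) → start o ; (inj₂ c) → created-src D c }
  ; tgt-pres = λ { (inj₁ o) → traced-tgt end D o ; (inj₂ c) → created-tgt end D c }
  }
  where
  open LabelledDerivations G edge
  open Realisation G edge

  toEdge : Occ α ⊎ Created (erase D) → Edge G
  toEdge (inj₁ o) = L ! o
  toEdge (inj₂ c) = created D c

  toEdge-injective : ∀ x y → toEdge x ≡ toEdge y → x ≡ y
  toEdge-injective (inj₁ o) (inj₁ o′) eq =
    cong inj₁ (inj₁-injective (trans (sym (start o)) (trans (cong (src G) eq) (start o′))))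
  toEdge-injective (inj₁ o) (inj₂ c) eq with trans (sym (start o)) (trans (cong (src G) eq) (created-src D c))
  ... | ()
  toEdge-injective (inj₂ c) (inj₁ o) eq with trans (sym (start o)) (trans (cong (src G) (sym eq)) (created-src D c))
  ... | ()
  toEdge-injective (inj₂ c) (inj₂ c′) eq = cong inj₂ (created-injective D unique c c′ eq)

  toEdge-surjective : ∀ e → ∃ λ x → toEdge x ≡ e
  toEdge-surjective e with src G e in eq
  ... | inj₁ o = inj₁ o , start! e o eq
  ... | inj₂ v with vertex-surjective D (total v)
  ... | x , refl with created-complete D x e eq
  ... | c , p = inj₂ c , p

-- Labelling a given derivation along an isomorphism of its flow

vertexList : ∀ {Y : Set} (Φ : Deriv α β) → (DVtx Φ → Y) → List Y
vertexList [] f = []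
vertexList (astep ξ ρ ∷ Φ) f = f (inj₁ tt) ∷ vertexList Φ (f ∘ inj₂)
vertexList (lstep ξ ρ ∷ Φ) f = vertexList Φ f

vertexList-∈ : ∀ {Y : Set} (Φ : Deriv α β) (f : DVtx Φ → Y) x → f x ∈ vertexList Φ f
vertexList-∈ (astep ξ ρ ∷ Φ) f (inj₁ _) = here refl
vertexList-∈ (astep ξ ρ ∷ Φ) f (inj₂ x) = there (vertexList-∈ Φ (f ∘ inj₂) x)
vertexList-∈ (lstep ξ ρ ∷ Φ) f x = vertexList-∈ Φ f x

vertexList-All : ∀ {Y : Set} {P : Y → Set} (Φ : Deriv α β) (f : DVtx Φ → Y) →
  (∀ x → P (f x)) → All P (vertexList Φ f)
vertexList-All [] f p = []
vertexList-All (astep ξ ρ ∷ Φ) f p = p (inj₁ tt) ∷ vertexList-All Φ (f ∘ inj₂) (p ∘ inj₂)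
vertexList-All (lstep ξ ρ ∷ Φ) f p = vertexList-All Φ f p

vertexList-Unique : ∀ {Y : Set} (Φ : Deriv α β) (f : DVtx Φ → Y) →
  (∀ x y → f x ≡ f y → x ≡ y) → Unique (vertexList Φ f)
vertexList-Unique [] f inj = []
vertexList-Unique (astep ξ ρ ∷ Φ) f inj =
  vertexList-All Φ (f ∘ inj₂) (λ x eq → inj₁≢inj₂ (inj _ _ eq)) ∷
  vertexList-Unique Φ (f ∘ inj₂) (λ x y eq → inj₂-injective (inj _ _ eq))
  where
  inj₁≢inj₂ : ∀ {A B : Set} {a : A} {b : B} → inj₁ a ≢ inj₂ b
  inj₁≢inj₂ ()
vertexList-Unique (lstep ξ ρ ∷ Φ) f inj = vertexList-Unique Φ f inj

createdAtom : (Φ : Deriv α β) → Created Φ → Atom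
createdAtom (astep ξ ρ ∷ Φ) (inj₁ o) = at o
createdAtom (astep ξ ρ ∷ Φ) (inj₂ c) = createdAtom Φ c
createdAtom (lstep ξ ρ ∷ Φ) c = createdAtom Φ c

flowAtom : (Φ : Deriv α β) → Edge (flowOf Φ) → Atom
flowAtom Φ (inj₁ o) = at o
flowAtom Φ (inj₂ c) = createdAtom Φ c

EdgeWithAtom : ∀ {I O} (G : Graph I O) → (Edge G → Atom) → Atom → Set
EdgeWithAtom G κ a = Σ (Edge G) λ e → κ e ≡ a

module _ {I : Set} {β} (G : Graph I (Occ β)) (κ : Edge G → Atom) where

  open LabelledDerivations G {EdgeWithAtom G κ} (λ _ → proj₁)

  -- Labels are pushed down from the premiss, and `L′` is whatever arrives. The hypotheses are the
  -- parts of an isomorphism that survive the removal of the first step. The flow of the tail is in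
  -- general not isomorphic to `G`, so surjectivity is asked only for edges leaving a vertex in the
  -- range of `V`, and the clause on `createdSrc` keeps such an edge in the tail.
  label : (Φ : Deriv α β) (L : Labelling (EdgeWithAtom G κ) α) (V : DVtx Φ → Vtx G) (K : Created Φ → Edge G) →
    (∀ c → κ (K c) ≡ createdAtom Φ c) →
    (∀ x → kind G (V x) ≡ dkind Φ x) →
    (∀ c → src G (K c) ≡ inj₂ (V (createdSrc Φ c))) →
    (∀ o → tgt G (L ! o) ≡ map₂ V (trace Φ o)) →
    (∀ c → tgt G (K c) ≡ map₂ V (createdTgt Φ c)) →
    (∀ c c′ → K c ≡ K c′ → c ≡ c′) →
    (∀ x e → src G e ≡ inj₂ (V x) → ∃ λ c → K c ≡ e × createdSrc Φ c ≡ x) →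
    ∃ λ L′ → (∀ o → tgt G (L′ ! o) ≡ inj₁ o) × LDeriv L L′ (vertexList Φ V)
  label [] L V K _ _ _ tgtL _ _ _ = L , tgtL , []
  label (astep {δ = δ} ξ ρ ∷ Φ) L V K atomK kindV srcK tgtL tgtK injK surK =
    let L′ , end , D = label Φ (plug ξ L M) (V ∘ inj₂) (K ∘ inj₂) (atomK ∘ inj₂) (kindV ∘ inj₂) (srcK ∘ inj₂)
                         tgtL′ (λ c → trans (tgtK (inj₂ c)) (map₂-map₂ (createdTgt Φ c)))
                         (λ c c′ eq → inj₂-injective (injK _ _ eq)) surK′
    in L′ , end , astep ξ ρ M (V (inj₁ tt)) (kindV _) consumed
         (creates (λ o → trans (cong (src G) (M-! o)) (srcK (inj₁ o)))
                  (λ o o′ eq → inj₁-injective (injK _ _ (trans (sym (M-! o)) (trans eq (M-! o′)))))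
                  surM) D
    where
    M : Labelling (EdgeWithAtom G κ) δ
    M = tabulate λ o → K (inj₁ o) , atomK (inj₁ o)

    M-! : ∀ o → M ! o ≡ K (inj₁ o)
    M-! = tabulate-! _

    consumed : Consumes (hole ξ L) (V (inj₁ tt))
    -- The trace of an occurrence in the redex stops at this very step, which computes once `ctxOcc`
    -- is known to find it in the hole.
    consumed h with tgtL (inHole ξ h)
    ... | eq rewrite ctxOcc-inHole {δ = δ} ξ h = trans (cong (tgt G) (hole-! ξ L h)) eq

    surM : ∀ e → src G e ≡ inj₂ (V (inj₁ tt)) → ∃ λ o → M ! o ≡ e
    surM e eq with surK (inj₁ tt) e eq
    ... | inj₁ o , p , _ = o , trans (M-! o) p
    ... | inj₂ c , _ , ()

    surK′ : ∀ x e → src G e ≡ inj₂ (V (inj₂ x)) → ∃ λ c → K (inj₂ c) ≡ e × createdSrc Φ c ≡ x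
    surK′ x e eq with surK (inj₂ x) e eq
    ... | inj₂ c , p , q = c , p , inj₂-injective q

    tgtL′ : ∀ o → tgt G (plug ξ L M ! o) ≡ map₂ (V ∘ inj₂) (trace Φ o)
    tgtL′ o with ctxOcc-origin ξ o
    ... | inj₁ (h , refl) =
      trans (cong (tgt G) (trans (plug-! ξ L M h) (M-! h)))
        (trans (tgtK (inj₁ h)) (map₂-map₂ (trace Φ (inHole ξ h))))
    ... | inj₂ (o′ , eq) with ctxOcc-! ξ L M o′ | tgtL o′
    ... | p | q rewrite eq = trans (cong (tgt G) p) (trans q (map₂-map₂ (trace Φ o)))
  label (lstep {δ = δ} ξ ρ ∷ Φ) L V K atomK kindV srcK tgtL tgtK injK surK =
    let L′ , end , D = label Φ _ V K atomK kindV srcK tgtL′ tgtK injK surK in L′ , end , lstep ξ ρ D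
    where
    tgtL′ : ∀ o → tgt G (plug ξ L (act ρ (hole ξ L)) ! o) ≡ map₂ V (trace Φ o)
    tgtL′ o with ctxOcc-origin ξ o
    ... | inj₂ (o′ , eq) with ctxOcc-! ξ L (act ρ (hole ξ L)) o′ | tgtL o′
    ... | p | q rewrite eq = trans (cong (tgt G) p) q
    tgtL′ o | inj₁ (h , refl) with lmap⁻¹ ρ h
    ... | h′ , refl with tgtL (inHole ξ h′)
    ... | q rewrite ctxOcc-inHole {δ = δ} ξ h′ =
      trans (cong (tgt G) (trans (plug-! ξ L _ _) (trans (act-! ρ _ h′) (hole-! ξ L h′)))) q

-- The atom of an edge is recorded in the labels, so that the two
-- edges ε₂ and ε₃ come out with the same atom.
labelled : ∀ {α β} (G : Graph (Occ α) (Occ β)) (Φ : Deriv α β) → flowOf Φ ≅ G →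
  ∃ λ κ → let open LabelledDerivations G {EdgeWithAtom G κ} (λ _ → proj₁) in
  ∃ λ L → ∃ λ L′ → ∃ λ us →
    LDeriv L L′ us × (∀ o → src G (L ! o) ≡ inj₁ o) × (∀ o → tgt G (L′ ! o) ≡ inj₁ o) ×
    Unique us × (∀ v → v ∈ us)
labelled {α} G Φ i =
  let L′ , end , D = label G κ Φ L V K (λ c → cong (flowAtom Φ) (E.strictlyInverseʳ (inj₂ c))) kind-pres
                       (λ c → src-pres (inj₂ c)) (λ o → trans (cong (tgt G) (L-! o)) (tgt-pres (inj₁ o)))
                       (λ c → tgt-pres (inj₂ c)) (λ c c′ eq → inj₂-injective (to-injective edge-iso eq)) surK
  in κ , L , L′ , _ , D , (λ o → trans (cong (src G) (L-! o)) (src-pres (inj₁ o))) , end ,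
     vertexList-Unique Φ V (λ _ _ → to-injective vtx-iso) ,
     λ v → subst (_∈ _) (W.strictlyInverseˡ v) (vertexList-∈ Φ V (W.from v))
  where
  open _≅_ i
  module E = Inverse edge-iso
  module W = Inverse vtx-iso

  to-injective : ∀ {A B : Set} (f : A ↔ B) {x y} → Inverse.to f x ≡ Inverse.to f y → x ≡ y
  to-injective f eq = trans (sym (Inverse.strictlyInverseʳ f _)) (trans (cong (Inverse.from f) eq) (Inverse.strictlyInverseʳ f _))

  V = W.to
  K : Created Φ → Edge G
  K c = E.to (inj₂ c)

  κ : Edge G → Atom
  κ e = flowAtom Φ (E.from e)

  open LabelledDerivations G {EdgeWithAtom G κ} (λ _ → proj₁)

  L : Labelling (EdgeWithAtom G κ) α
  L = tabulate λ o → E.to (inj₁ o) , cong (flowAtom Φ) (E.strictlyInverseʳ (inj₁ o))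

  L-! : ∀ o → L ! o ≡ E.to (inj₁ o)
  L-! = tabulate-! _

  surK : ∀ x e → src G e ≡ inj₂ (V x) → ∃ λ c → K c ≡ e × createdSrc Φ c ≡ x
  surK x e eq with E.from e | E.strictlyInverseˡ e
  ... | inj₁ o | refl with trans (sym (src-pres (inj₁ o))) eq
  ... | ()
  surK x e eq | inj₂ c | refl =
    c , refl , to-injective vtx-iso (inj₂-injective (trans (sym (src-pres (inj₂ c))) eq))

-- The reduct

-- A two-element set in pointed form: applied to ε₁, it yields the partner edge at ν or at μ.
Other : {E : Set} → (E → Set) → Set
Other P = ∀ e → P e → ∃ λ e′ → P e′ × e′ ≢ e × (∀ e″ → P e″ → e″ ≢ e → e″ ≡ e′)

-- The partner is the other index of `Fin 2`; irrelevance of `P` lets an equality of edges be read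
-- as an equality of pairs.
other : ∀ {E : Set} {P : E → Set} → (∀ {e} (p q : P e) → p ≡ q) → Fin 2 ↔ Σ E P → Other P
other {E} {P} irr i e p with I.from (e , p) in eq
  where module I = Inverse i
... | k = proj₁ (I.to (swap k)) , proj₂ (I.to (swap k)) , (λ eq′ → swap-≢ k (trans (sym (I.strictlyInverseʳ (swap k))) (trans (cong I.from (pair-≡ eq′)) eq))) ,
  λ e″ p″ e″≢e → cong proj₁ (trans (sym (I.strictlyInverseˡ (e″ , p″)))
    (cong I.to (only k (I.from (e″ , p″)) λ eq″ → e″≢e (cong proj₁ (from-injective (trans eq″ (sym eq)))))))
  where
  module I = Inverse i
  swap : Fin 2 → Fin 2
  swap zero = suc zero
  swap (suc _) = zero
  swap-≢ : ∀ k → swap k ≢ k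
  swap-≢ zero ()
  swap-≢ (suc zero) ()
  only : ∀ k l → l ≢ k → l ≡ swap k
  only zero zero l≢k = ⊥-elim (l≢k refl)
  only zero (suc zero) _ = refl
  only (suc zero) zero _ = refl
  only (suc zero) (suc zero) l≢k = ⊥-elim (l≢k refl)
  from-injective : ∀ {x y} → I.from x ≡ I.from y → x ≡ y
  from-injective eq = trans (sym (I.strictlyInverseˡ _)) (trans (cong I.to eq) (I.strictlyInverseˡ _))
  pair-≡ : {x y : Σ E P} → proj₁ x ≡ proj₁ y → x ≡ y
  pair-≡ refl = cong (_ ,_) (irr _ _)

module _ {I O : Set} {B G : Graph I O} (flow : IsAtomicFlow B) (j : B ≅ G) where

  private
    open IsAtomicFlow flow
    module J = _≅_ j
    module J⁻¹ = _≅_ (≅-sym j)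
    module E = Inverse J.edge-iso
    module V = Inverse J.vtx-iso

    Other-transport : {P : Edge B → Set} {Q : Edge G → Set} → (∀ e → P e → Q (E.to e)) → (∀ e → Q e → P (E.from e)) →
      Other P → Other Q
    Other-transport P⇒Q Q⇒P o e q with o (E.from e) (Q⇒P e q)
    ... | e′ , p′ , e′≢ , uniq = E.to e′ , P⇒Q e′ p′ ,
      (λ eq → e′≢ (trans (sym (E.strictlyInverseʳ e′)) (cong E.from eq))) ,
      λ e″ q″ e″≢ → trans (sym (E.strictlyInverseˡ e″)) (cong E.to (uniq (E.from e″) (Q⇒P e″ q″)
        λ eq → e″≢ (trans (sym (E.strictlyInverseˡ e″)) (trans (cong E.to eq) (E.strictlyInverseˡ e)))))

  -- Degrees are known of `B` only, hence counted there and carried across `j`.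
  other-lower : ∀ v → nLow (kind G v) ≡ 2 → Other (λ e → src G e ≡ inj₂ v)
  other-lower v two = Other-transport {P = λ e → src B e ≡ inj₂ (V.from v)}
    (λ e p → trans (J.src-pres e) (trans (cong (map₂ V.to) p) (cong inj₂ (V.strictlyInverseˡ v))))
    (λ e p → trans (J⁻¹.src-pres e) (cong (map₂ V.from) p))
    (other ≡-irrelevant (subst (λ n → Fin n ↔ Σ _ λ e → src B e ≡ inj₂ (V.from v)) (trans (cong nLow (J⁻¹.kind-pres v)) two) (lower-edges (V.from v))))

  other-upper : ∀ v → nUp (kind G v) ≡ 2 → Other (λ e → tgt G e ≡ inj₂ v)
  other-upper v two = Other-transport {P = λ e → tgt B e ≡ inj₂ (V.from v)}
    (λ e p → trans (J.tgt-pres e) (trans (cong (map₂ V.to) p) (cong inj₂ (V.strictlyInverseˡ v))))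
    (λ e p → trans (J⁻¹.tgt-pres e) (cong (map₂ V.from) p))
    (other ≡-irrelevant (subst (λ n → Fin n ↔ Σ _ λ e → tgt B e ≡ inj₂ (V.from v)) (trans (cong nUp (J⁻¹.kind-pres v)) two) (upper-edges (V.from v))))

  upper-unique : ∀ {i} e e′ → src G e ≡ inj₁ i → src G e′ ≡ inj₁ i → e ≡ e′
  upper-unique {i} e e′ p p′ =
    trans (sym (E.strictlyInverseˡ e)) (trans (cong (E.to ∘ proj₁) same) (E.strictlyInverseˡ e′))
    where
    pull : ∀ {e} → src G e ≡ inj₁ i → Σ (Edge B) λ e → src B e ≡ inj₁ i
    pull {e} p = E.from e , trans (J⁻¹.src-pres e) (cong (map₂ V.from) p)
    module U = Inverse (upper-bd i)
    same : pull p ≡ pull p′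
    same = trans (sym (U.strictlyInverseˡ (pull p))) (U.strictlyInverseˡ (pull p′))

module Inversion {I O : Set} (A : Graph (I ⊎ ⊤) (O ⊎ ⊤)) where

  private G = withSimpleEdge A

  -- `src G (inj₁ e)` is stuck on `src A e`, and inspecting the latter makes each case compute. The
  -- other lemmas of this module follow the same pattern.
  src-inner : ∀ {e v} → src G (inj₁ e) ≡ inj₂ (inj₁ v) → src A e ≡ inj₂ v
  src-inner {e} eq with src A e
  src-inner refl | inj₂ v = refl
  src-inner () | inj₁ (inj₁ _)
  src-inner () | inj₁ (inj₂ _)

  src-ν : ∀ {e} → src G (inj₁ e) ≡ inj₂ (inj₂ ν) → src A e ≡ inj₁ (inj₂ tt)
  src-ν {e} eq with src A e
  src-ν eq | inj₁ (inj₂ tt) = refl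
  src-ν () | inj₁ (inj₁ _)
  src-ν () | inj₂ _

  src-upper : ∀ {e i} → src G (inj₁ e) ≡ inj₁ i → src A e ≡ inj₁ (inj₁ i)
  src-upper {e} eq with src A e
  src-upper refl | inj₁ (inj₁ i) = refl
  src-upper () | inj₁ (inj₂ _)
  src-upper () | inj₂ _

  src-inner⁺ : ∀ {e v} → src A e ≡ inj₂ v → src G (inj₁ e) ≡ inj₂ (inj₁ v)
  src-inner⁺ {e} eq with src A e
  src-inner⁺ refl | .(inj₂ _) = refl

  src-ν⁺ : ∀ {e} → src A e ≡ inj₁ (inj₂ tt) → src G (inj₁ e) ≡ inj₂ (inj₂ ν)
  src-ν⁺ {e} eq with src A e
  src-ν⁺ refl | .(inj₁ (inj₂ tt)) = refl

  src-upper⁺ : ∀ {e i} → src A e ≡ inj₁ (inj₁ i) → src G (inj₁ e) ≡ inj₁ i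
  src-upper⁺ {e} eq with src A e
  src-upper⁺ refl | .(inj₁ (inj₁ _)) = refl

  tgt-inner : ∀ {e v} → tgt G (inj₁ e) ≡ inj₂ (inj₁ v) → tgt A e ≡ inj₂ v
  tgt-inner {e} eq with tgt A e
  tgt-inner refl | inj₂ v = refl
  tgt-inner () | inj₁ (inj₁ _)
  tgt-inner () | inj₁ (inj₂ _)

  tgt-μ : ∀ {e} → tgt G (inj₁ e) ≡ inj₂ (inj₂ μ) → tgt A e ≡ inj₁ (inj₂ tt)
  tgt-μ {e} eq with tgt A e
  tgt-μ eq | inj₁ (inj₂ tt) = refl
  tgt-μ () | inj₁ (inj₁ _)
  tgt-μ () | inj₂ _

  tgt-μ⁺ : ∀ {e} → tgt A e ≡ inj₁ (inj₂ tt) → tgt G (inj₁ e) ≡ inj₂ (inj₂ μ)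
  tgt-μ⁺ {e} eq with tgt A e
  tgt-μ⁺ refl | .(inj₁ (inj₂ tt)) = refl

  tgt-lower : ∀ {e j} → tgt G (inj₁ e) ≡ inj₁ j → tgt A e ≡ inj₁ (inj₁ j)
  tgt-lower {e} eq with tgt A e
  tgt-lower refl | inj₁ (inj₁ j) = refl
  tgt-lower () | inj₁ (inj₂ _)
  tgt-lower () | inj₂ _

-- Edges of the reduct by source and target

module Reduct {I O : Set} (A : Graph (I ⊎ ⊤) (O ⊎ ⊤))
  (ε₂ : Edge A) (ε₂-src : src A ε₂ ≡ inj₁ (inj₂ tt)) (ε₂-unique : ∀ {e} → src A e ≡ inj₁ (inj₂ tt) → e ≡ ε₂)
  (ε₃ : Edge A) (ε₃-tgt : tgt A ε₃ ≡ inj₁ (inj₂ tt)) where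

  H = reduct A ε₂

  NotSlot-irrelevant : ∀ {X V : Set} (x : (X ⊎ ⊤) ⊎ V) (p q : NotSlot x) → p ≡ q
  NotSlot-irrelevant (inj₁ (inj₁ _)) p q = refl
  NotSlot-irrelevant (inj₂ _) p q = refl

  data View (e : Edge A) : Set where
    slot : src A e ≡ inj₁ (inj₂ tt) → View e
    nonslot : NotSlot (src A e) → View e

  view : ∀ e → View e
  view e with src A e in eq
  ... | inj₁ (inj₁ _) = nonslot (subst NotSlot (sym eq) tt)
  ... | inj₁ (inj₂ _) = slot eq
  ... | inj₂ _ = nonslot (subst NotSlot (sym eq) tt)

  -- The copy of an edge in Â, where ε̂₂ is the edge ε̃₃.
  edge^′ : Edge A → CEdge A
  edge^′ e with view e
  ... | slot _ = edge˜ ε₃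
  ... | nonslot p = edge^ e p

  edge^′-nonslot : ∀ {e} (p : NotSlot (src A e)) → edge^′ e ≡ edge^ e p
  edge^′-nonslot {e} p with view e
  ... | slot eq = ⊥-elim (subst NotSlot eq p)
  ... | nonslot q = cong (edge^ e) (NotSlot-irrelevant (src A e) q p)

  edge^′-inner : ∀ {e v} → src A e ≡ inj₂ v → ∃ λ p → edge^′ e ≡ edge^ e p
  edge^′-inner eq = _ , edge^′-nonslot (subst NotSlot (sym eq) tt)

  edge^′-slot : edge^′ ε₂ ≡ edge˜ ε₃
  edge^′-slot with view ε₂
  ... | slot _ = refl
  ... | nonslot p = ⊥-elim (subst NotSlot ε₂-src p)

  edge˜-src-inner : ∀ {e v} → src A e ≡ inj₂ v → src H (edge˜ e) ≡ inj₂ (copy˜ v)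
  edge˜-src-inner {e} eq with src A e
  edge˜-src-inner refl | .(inj₂ _) = refl

  edge˜-src-slot : ∀ {e} → src A e ≡ inj₁ (inj₂ tt) → src H (edge˜ e) ≡ inj₂ newW
  edge˜-src-slot {e} eq with src A e
  edge˜-src-slot refl | .(inj₁ (inj₂ tt)) = refl

  edge˜-src-upper : ∀ {e i} → src A e ≡ inj₁ (inj₁ i) → src H (edge˜ e) ≡ inj₂ (coctr i)
  edge˜-src-upper {e} eq with src A e
  edge˜-src-upper refl | .(inj₁ (inj₁ _)) = refl

  edge^-src-inner : ∀ {e v} (p : NotSlot (src A e)) → src A e ≡ inj₂ v → src H (edge^ e p) ≡ inj₂ (copy^ v)
  edge^-src-inner {e} p eq with src A e
  edge^-src-inner p refl | .(inj₂ _) = refl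

  edge^-src-upper : ∀ {e i} (p : NotSlot (src A e)) → src A e ≡ inj₁ (inj₁ i) → src H (edge^ e p) ≡ inj₂ (coctr i)
  edge^-src-upper {e} p eq with src A e
  edge^-src-upper p refl | .(inj₁ (inj₁ _)) = refl

  edge^′-src-inner : ∀ {e v} → src A e ≡ inj₂ v → src H (edge^′ e) ≡ inj₂ (copy^ v)
  edge^′-src-inner eq with edge^′-inner eq
  ... | p , eq′ = trans (cong (src H) eq′) (edge^-src-inner p eq)

  edge^′-src-upper : ∀ {e i} → src A e ≡ inj₁ (inj₁ i) → src H (edge^′ e) ≡ inj₂ (coctr i)
  edge^′-src-upper {e} eq with subst NotSlot (sym eq) tt
  ... | p = trans (cong (src H) (edge^′-nonslot p)) (edge^-src-upper p eq)

  edge˜-tgt-inner : ∀ {e v} → tgt A e ≡ inj₂ v → tgt H (edge˜ e) ≡ inj₂ (copy˜ v)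
  edge˜-tgt-inner {e} eq with tgt A e
  edge˜-tgt-inner refl | .(inj₂ _) = refl

  edge˜-tgt-lower : ∀ {e j} → tgt A e ≡ inj₁ (inj₁ j) → tgt H (edge˜ e) ≡ inj₂ (ctr j)
  edge˜-tgt-lower {e} eq with tgt A e
  edge˜-tgt-lower refl | .(inj₁ (inj₁ _)) = refl

  data Target : (O ⊎ ⊤) ⊎ Vtx A → O ⊎ CVtx (Vtx A) I O → Set where
    inner : ∀ {v} → Target (inj₂ v) (inj₂ (copy^ v))
    lower : ∀ {j} → Target (inj₁ (inj₁ j)) (inj₂ (ctr j))
    slot : Target (inj₁ (inj₂ tt)) (inj₂ newCoW)

  edge˜-tgt-slot : ∀ {e} → tgt A e ≡ inj₁ (inj₂ tt) → Target (tgt A ε₂) (tgt H (edge˜ e))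
  edge˜-tgt-slot {e} eq with tgt A e
  edge˜-tgt-slot refl | .(inj₁ (inj₂ tt)) with tgt A ε₂
  ... | inj₁ (inj₁ _) = lower
  ... | inj₁ (inj₂ _) = slot
  ... | inj₂ _ = inner

  -- ε₂ is no exception: its copy is `edge˜ ε₃`, whose target is by definition that of ε̂₂. This
  -- covers the case ε₂ = ε₃, where the glued edge ends in the new coweakening.
  edge^′-tgt : ∀ e → Target (tgt A e) (tgt H (edge^′ e))
  edge^′-tgt e with view e
  edge^′-tgt e | nonslot p with tgt A e
  ... | inj₁ (inj₁ _) = lower
  ... | inj₁ (inj₂ _) = slot
  ... | inj₂ _ = inner
  edge^′-tgt e | slot eq rewrite ε₂-unique eq = edge˜-tgt-slot ε₃-tgt

  edge^′-tgt-inner : ∀ {e v} → tgt A e ≡ inj₂ v → tgt H (edge^′ e) ≡ inj₂ (copy^ v)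
  edge^′-tgt-inner {e} eq with tgt A e | tgt H (edge^′ e) | edge^′-tgt e
  edge^′-tgt-inner refl | _ | _ | inner = refl

  edge^′-tgt-lower : ∀ {e j} → tgt A e ≡ inj₁ (inj₁ j) → tgt H (edge^′ e) ≡ inj₂ (ctr j)
  edge^′-tgt-lower {e} eq with tgt A e | tgt H (edge^′ e) | edge^′-tgt e
  edge^′-tgt-lower refl | _ | _ | lower = refl

  edge^′-tgt-slot : ∀ {e} → tgt A e ≡ inj₁ (inj₂ tt) → tgt H (edge^′ e) ≡ inj₂ newCoW
  edge^′-tgt-slot {e} eq with tgt A e | tgt H (edge^′ e) | edge^′-tgt e
  edge^′-tgt-slot refl | _ | _ | slot = refl

  -- Phrased with `edge^′` so that the two copies look alike. Inverting `source-of` lists all lower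
  -- edges of a vertex, as `Creates` demands; the missing case for `newCoW` says that the new
  -- coweakening has none.
  data Source (e : CEdge A) : I ⊎ CVtx (Vtx A) I O → Set where
    inner˜ : ∀ {e′ v} → e ≡ edge˜ e′ → src A e′ ≡ inj₂ v → Source e (inj₂ (copy˜ v))
    inner^ : ∀ {e′ v} → e ≡ edge^′ e′ → src A e′ ≡ inj₂ v → Source e (inj₂ (copy^ v))
    slot˜ : e ≡ edge˜ ε₂ → Source e (inj₂ newW)
    upper˜ : ∀ {e′ i} → e ≡ edge˜ e′ → src A e′ ≡ inj₁ (inj₁ i) → Source e (inj₂ (coctr i))
    upper^ : ∀ {e′ i} → e ≡ edge^′ e′ → src A e′ ≡ inj₁ (inj₁ i) → Source e (inj₂ (coctr i))
    upper : ∀ {i} → e ≡ upE i → Source e (inj₁ i)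
    lower : ∀ {j} → e ≡ lowE j → Source e (inj₂ (ctr j))

  edge-source : ∀ e → Source e (src H e)
  edge-source (edge˜ e) with src A e in eq
  ... | inj₁ (inj₁ i) = upper˜ refl eq
  ... | inj₁ (inj₂ tt) = slot˜ (cong edge˜ (ε₂-unique eq))
  ... | inj₂ v = inner˜ refl eq
  edge-source (edge^ e p) = at-source _ refl
    where
    at-source : ∀ z → src A e ≡ z → Source (edge^ e p) (src H (edge^ e p))
    at-source (inj₁ (inj₁ i)) eq = subst (Source _) (sym (edge^-src-upper p eq)) (upper^ (sym (edge^′-nonslot p)) eq)
    at-source (inj₁ (inj₂ _)) eq = ⊥-elim (subst NotSlot eq p)
    at-source (inj₂ v) eq = subst (Source _) (sym (edge^-src-inner p eq)) (inner^ (sym (edge^′-nonslot p)) eq)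
  edge-source (upE i) = upper refl
  edge-source (lowE j) = lower refl

  source-of : ∀ {e z} → src H e ≡ z → Source e z
  source-of {e} refl = edge-source e

-- Dual atoms and derived rules

bar-≢ : ∀ a → a ≢ bar a
bar-≢ (pos _) ()
bar-≢ (neg _) ()

bar-involutive : ∀ a → bar (bar a) ≡ a
bar-involutive (pos _) = refl
bar-involutive (neg _) = refl

module DerivedRules {I O : Set} (G : Graph I O) {X : Atom → Set} (edge : ∀ a → X a → Edge G) where

  open LabelledDerivations G edge

  private variable
    us : List (Vtx G)
    L : Labelling X α
    M : Labelling X β
    N : Labelling X γ
    P : Labelling X δ

  -- Composition with a derivation that uses no vertex: the index stays `us` instead of becoming
  -- `us ++ []`.
  infixl 4 _▸_
  _▸_ : LDeriv L M us → LDeriv M N [] → LDeriv L N us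
  [] ▸ E = E
  astep ξ ρ M v k c d D ▸ E = astep ξ ρ M v k c d (D ▸ E)
  lstep ξ ρ D ▸ E = lstep ξ ρ (D ▸ E)

  ∨-swap : LDeriv (L ∨ᴸ M) (M ∨ᴸ L) []
  ∨-swap = rule (∨-comm _ _)

  ∧-swap : LDeriv (L ∧ᴸ M) (M ∧ᴸ L) []
  ∧-swap = rule (∧-comm _ _)

  ∨-exchange : LDeriv ((L ∨ᴸ M) ∨ᴸ (N ∨ᴸ P)) ((L ∨ᴸ N) ∨ᴸ (M ∨ᴸ P)) []
  ∨-exchange =
    rule (∨-assoc _ _ _) ▸ ∨-liftʳ (rule (∨-assoc⁻¹ _ _ _) ▸ ∨-liftˡ ∨-swap ▸ rule (∨-assoc _ _ _)) ▸ rule (∨-assoc⁻¹ _ _ _)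

  ∧-exchange : LDeriv ((L ∧ᴸ M) ∧ᴸ (N ∧ᴸ P)) ((L ∧ᴸ N) ∧ᴸ (M ∧ᴸ P)) []
  ∧-exchange =
    rule (∧-assoc _ _ _) ▸ ∧-liftʳ (rule (∧-assoc⁻¹ _ _ _) ▸ ∧-liftˡ ∧-swap ▸ rule (∧-assoc _ _ _)) ▸ rule (∧-assoc⁻¹ _ _ _)

  switchʳ : LDeriv ((M ∨ᴸ P) ∧ᴸ N) (M ∨ᴸ (P ∧ᴸ N)) []
  switchʳ = ∧-swap ▸ ∧-liftʳ ∨-swap ▸ rule (switch _ _ _) ▸ ∨-swap ▸ ∨-liftʳ ∧-swap

  Creates-none : ∀ {v} {M : Labelling X δ} → (Occ δ → ⊥) → (∀ e → src G e ≢ inj₂ v) → Creates M v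
  Creates-none empty none = creates (λ o → ⊥-elim (empty o)) (λ o → ⊥-elim (empty o)) (λ e eq → ⊥-elim (none e eq))

  Creates-one : ∀ {v a} {x : X a} → src G (edge a x) ≡ inj₂ v → (∀ e → src G e ≡ inj₂ v → edge a x ≡ e) →
    Creates (atomᴸ x) v
  Creates-one s u = creates (λ { here → s }) (λ { here here _ → refl }) (λ e eq → here , u e eq)

-- Substituting a unit u for the simple edge

module Substitution {I O O′ : Set} (A : Graph (I ⊎ ⊤) (O ⊎ ⊤)) (H : Graph I O′) (κ : Edge (withSimpleEdge A) → Atom)
  (u : Formula) (uᴸ : ∀ {X} → Labelling X u)
  (f : Edge A → Edge H) (g : Vtx A → Vtx H)
  (g-kind : ∀ v → kind H (g v) ≡ kind A v)
  (f-tgt : ∀ {e v} → tgt A e ≡ inj₂ v → tgt H (f e) ≡ inj₂ (g v))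
  (f-src : ∀ {e v} → src A e ≡ inj₂ v → src H (f e) ≡ inj₂ (g v))
  (f-injective : ∀ {e e′ v} → src A e ≡ inj₂ v → src A e′ ≡ inj₂ v → f e ≡ f e′ → e ≡ e′)
  (f-complete : ∀ {e v} → src H e ≡ inj₂ (g v) → ∃ λ e′ → e ≡ f e′ × src A e′ ≡ inj₂ v) where

  private
    G = withSimpleEdge A
    Y : Atom → Set
    Y = EdgeWithAtom G κ
    module S = LabelledDerivations G {Y} (λ _ → proj₁)

  open Inversion A
  open LabelledDerivations H {λ _ → Edge H} (λ _ → id)
  open DerivedRules H {λ _ → Edge H} (λ _ → id)

  -- The label decides what is replaced, not the atom: other occurrences of the atom of ε₁ are kept.
  subᶠ : Labelling Y γ → Formula
  subᶠ 𝖿ᴸ = 𝖿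
  subᶠ 𝗍ᴸ = 𝗍
  subᶠ (atomᴸ {a} (inj₁ _ , _)) = atom a
  subᶠ (atomᴸ (inj₂ _ , _)) = u
  subᶠ (L ∨ᴸ N) = subᶠ L ∨ subᶠ N
  subᶠ (L ∧ᴸ N) = subᶠ L ∧ subᶠ N

  sub : (L : Labelling Y γ) → Labelling (λ _ → Edge H) (subᶠ L)
  sub 𝖿ᴸ = 𝖿ᴸ
  sub 𝗍ᴸ = 𝗍ᴸ
  sub (atomᴸ (inj₁ e , _)) = atomᴸ (f e)
  sub (atomᴸ (inj₂ _ , _)) = uᴸ
  sub (L ∨ᴸ N) = sub L ∨ᴸ sub N
  sub (L ∧ᴸ N) = sub L ∧ᴸ sub N

  -- The context may itself contain ε₁, so the substituted formula need not have the form `ξ ⟦ _ ⟧`;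
  -- the derivation is lifted layer by layer through the substituted context.
  sub-plug : ∀ {us} ξ (L : Labelling Y (ξ ⟦ γ ⟧)) {M : Labelling Y δ} →
    LDeriv (sub (hole ξ L)) (sub M) us → LDeriv (sub L) (sub (plug ξ L M)) us
  sub-plug □ L D = D
  sub-plug (ξ ∨◁ β) (L ∨ᴸ N) D = ∨-liftˡ (sub-plug ξ L D)
  sub-plug (α ▷∨ ξ) (N ∨ᴸ L) D = ∨-liftʳ (sub-plug ξ L D)
  sub-plug (ξ ∧◁ β) (L ∧ᴸ N) D = ∧-liftˡ (sub-plug ξ L D)
  sub-plug (α ▷∧ ξ) (N ∧ᴸ L) D = ∧-liftʳ (sub-plug ξ L D)

  -- Linear rules mention no atom, so each of them is again an instance of itself after the
  -- substitution.
  sub-act : (ρ : LRule γ δ) (L : Labelling Y γ) → LDeriv (sub L) (sub (act ρ L)) []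
  sub-act (switch _ _ _) (_ ∧ᴸ (_ ∨ᴸ _)) = rule (switch _ _ _)
  sub-act (medial _ _ _ _) ((_ ∧ᴸ _) ∨ᴸ (_ ∧ᴸ _)) = rule (medial _ _ _ _)
  sub-act (∨-comm _ _) (_ ∨ᴸ _) = rule (∨-comm _ _)
  sub-act (∧-comm _ _) (_ ∧ᴸ _) = rule (∧-comm _ _)
  sub-act (∨-assoc _ _ _) ((_ ∨ᴸ _) ∨ᴸ _) = rule (∨-assoc _ _ _)
  sub-act (∨-assoc⁻¹ _ _ _) (_ ∨ᴸ (_ ∨ᴸ _)) = rule (∨-assoc⁻¹ _ _ _)
  sub-act (∧-assoc _ _ _) ((_ ∧ᴸ _) ∧ᴸ _) = rule (∧-assoc _ _ _)
  sub-act (∧-assoc⁻¹ _ _ _) (_ ∧ᴸ (_ ∧ᴸ _)) = rule (∧-assoc⁻¹ _ _ _)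
  sub-act (∨-unit _) (_ ∨ᴸ 𝖿ᴸ) = rule (∨-unit _)
  sub-act (∨-unit⁻¹ _) _ = rule (∨-unit⁻¹ _)
  sub-act (∧-unit _) (_ ∧ᴸ 𝗍ᴸ) = rule (∧-unit _)
  sub-act (∧-unit⁻¹ _) _ = rule (∧-unit⁻¹ _)
  sub-act 𝗍∨𝗍 (𝗍ᴸ ∨ᴸ 𝗍ᴸ) = rule 𝗍∨𝗍
  sub-act 𝗍∨𝗍⁻¹ 𝗍ᴸ = rule 𝗍∨𝗍⁻¹
  sub-act 𝖿∧𝖿 (𝖿ᴸ ∧ᴸ 𝖿ᴸ) = rule 𝖿∧𝖿
  sub-act 𝖿∧𝖿⁻¹ 𝖿ᴸ = rule 𝖿∧𝖿⁻¹

  -- `subᶠ N` reduces to `γ` only once all labels of `N` are known to be edges of `A`; hence `N′` is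
  -- kept over `γ` itself and compared label by label.
  record Copied (N : Labelling Y γ) (N′ : Labelling (λ _ → Edge H) γ) : Set where
    constructor copied
    field
      original : Occ γ → Edge A
      source-label : ∀ o → N S.! o ≡ inj₁ (original o)
      copy-label : ∀ o → N′ ! o ≡ f (original o)

  open Copied

  copy-Consumes : ∀ {v} {N : Labelling Y γ} {N′} → Copied N N′ → S.Consumes N (inj₁ v) → Consumes N′ (g v)
  copy-Consumes r c o = trans (cong (tgt H) (copy-label r o))
    (f-tgt (tgt-inner (trans (cong (tgt G) (sym (source-label r o))) (c o))))

  copy-Creates : ∀ {v} {M : Labelling Y δ} {M′} → Copied M M′ → S.Creates M (inj₁ v) → Creates M′ (g v)
  copy-Creates {v = v} {M} {M′} r d = creates
    (λ o → trans (cong (src H) (copy-label r o)) (f-src (original-src o)))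
    (λ o o′ eq → S.distinct d o o′ (trans (source-label r o) (trans (cong inj₁
      (f-injective (original-src o) (original-src o′) (trans (sym (copy-label r o)) (trans eq (copy-label r o′)))))
      (sym (source-label r o′)))))
    comp
    where
    original-src : ∀ o → src A (original r o) ≡ inj₂ v
    original-src o = src-inner (trans (cong (src G) (sym (source-label r o))) (S.source d o))
    comp : ∀ e → src H e ≡ inj₂ (g v) → ∃ λ o → M′ ! o ≡ e
    comp e eq with f-complete eq
    ... | e′ , refl , eq′ with S.complete d (inj₁ e′) (src-inner⁺ eq′)
    ... | o , p = o , trans (copy-label r o) (cong f (inj₁-injective (trans (sym (source-label r o)) p)))

  copy-atom : ∀ {a} e {p : κ (inj₁ e) ≡ a} → Copied (atomᴸ (inj₁ e , p)) (atomᴸ (f e))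
  copy-atom e = copied (λ { here → e }) (λ { here → refl }) (λ { here → refl })

  copy-∨ : {N : Labelling Y γ} {P : Labelling Y δ} → ∀ {N′ P′} → Copied N N′ → Copied P P′ → Copied (N ∨ᴸ P) (N′ ∨ᴸ P′)
  copy-∨ r s = copied (λ { (∨ˡ o) → original r o ; (∨ʳ o) → original s o })
    (λ { (∨ˡ o) → source-label r o ; (∨ʳ o) → source-label s o })
    (λ { (∨ˡ o) → copy-label r o ; (∨ʳ o) → copy-label s o })

  copy-∧ : {N : Labelling Y γ} {P : Labelling Y δ} → ∀ {N′ P′} → Copied N N′ → Copied P P′ → Copied (N ∧ᴸ P) (N′ ∧ᴸ P′)
  copy-∧ r s = copied (λ { (∧ˡ o) → original r o ; (∧ʳ o) → original s o })
    (λ { (∧ˡ o) → source-label r o ; (∧ʳ o) → source-label s o })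
    (λ { (∧ˡ o) → copy-label r o ; (∧ʳ o) → copy-label s o })

  copy-𝖿 : Copied 𝖿ᴸ 𝖿ᴸ
  copy-𝖿 = copied (λ ()) (λ ()) (λ ())

  copy-𝗍 : Copied 𝗍ᴸ 𝗍ᴸ
  copy-𝗍 = copied (λ ()) (λ ()) (λ ())

  created-inner : ∀ {a v} (x : Y a) → src G (proj₁ x) ≡ inj₂ (inj₁ v) → ∃ λ e → ∃ λ p → x ≡ (inj₁ e , p)
  created-inner (inj₁ e , p) _ = e , p , refl
  created-inner (inj₂ _ , _) ()

  consumed-inner : ∀ {a v} (x : Y a) → tgt G (proj₁ x) ≡ inj₂ (inj₁ v) → ∃ λ e → ∃ λ p → x ≡ (inj₁ e , p)
  consumed-inner (inj₁ e , p) _ = e , p , refl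
  consumed-inner (inj₂ _ , _) ()

  -- ε₁ runs from ν to μ, so no label at a vertex of `A` is touched by the substitution and the same
  -- rule applies to the copies.
  sub-arule : ∀ {k v} (ρ : ARule k γ δ) (N : Labelling Y γ) (M : Labelling Y δ) → kind A v ≡ k →
    S.Consumes N (inj₁ v) → S.Creates M (inj₁ v) → LDeriv (sub N) (sub M) (g v ∷ [])
  sub-arule {k = k} {v} ρ N M kv c d = go ρ N M c d
    where
    step : ∀ {γ δ} (ρ : ARule k γ δ) {N : Labelling Y γ} {M : Labelling Y δ} {N′ M′} →
      S.Consumes N (inj₁ v) → S.Creates M (inj₁ v) → Copied N N′ → Copied M M′ → LDeriv N′ M′ (g v ∷ [])
    step ρ c d r s = astep □ ρ _ (g v) (trans (g-kind v) kv) (copy-Consumes r c) (copy-Creates s d) []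
    go : ∀ {γ δ} (ρ : ARule k γ δ) (N : Labelling Y γ) (M : Labelling Y δ) →
      S.Consumes N (inj₁ v) → S.Creates M (inj₁ v) → LDeriv (sub N) (sub M) (g v ∷ [])
    go (ai↓ a) 𝗍ᴸ (atomᴸ x ∨ᴸ atomᴸ y) c d
      with created-inner x (S.source d (∨ˡ here)) | created-inner y (S.source d (∨ʳ here))
    ... | e , _ , refl | e′ , _ , refl = step (ai↓ a) c d copy-𝗍 (copy-∨ (copy-atom e) (copy-atom e′))
    go (aw↓ a) 𝖿ᴸ (atomᴸ x) c d with created-inner x (S.source d here)
    ... | e , _ , refl = step (aw↓ a) c d copy-𝖿 (copy-atom e)
    go (ac↓ a) (atomᴸ x ∨ᴸ atomᴸ y) (atomᴸ z) c d
      with consumed-inner x (c (∨ˡ here)) | consumed-inner y (c (∨ʳ here)) | created-inner z (S.source d here)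
    ... | e , _ , refl | e′ , _ , refl | e″ , _ , refl =
      step (ac↓ a) c d (copy-∨ (copy-atom e) (copy-atom e′)) (copy-atom e″)
    go (ai↑ a) (atomᴸ x ∧ᴸ atomᴸ y) 𝖿ᴸ c d
      with consumed-inner x (c (∧ˡ here)) | consumed-inner y (c (∧ʳ here))
    ... | e , _ , refl | e′ , _ , refl = step (ai↑ a) c d (copy-∧ (copy-atom e) (copy-atom e′)) copy-𝖿
    go (aw↑ a) (atomᴸ x) 𝗍ᴸ c d with consumed-inner x (c here)
    ... | e , _ , refl = step (aw↑ a) c d (copy-atom e) copy-𝗍
    go (ac↑ a) (atomᴸ x) (atomᴸ y ∧ᴸ atomᴸ z) c d
      with consumed-inner x (c here) | created-inner y (S.source d (∧ˡ here)) | created-inner z (S.source d (∧ʳ here))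
    ... | e , _ , refl | e′ , _ , refl | e″ , _ , refl =
      step (ac↑ a) c d (copy-atom e) (copy-∧ (copy-atom e′) (copy-atom e″))

  module _ (bad : Vtx G) (image : Vtx G → List (Vtx H))
    (step : ∀ {γ δ k} (ρ : ARule k γ δ) (N : Labelling Y γ) (M : Labelling Y δ) v → bad ≢ v → kind G v ≡ k →
      S.Consumes N v → S.Creates M v → LDeriv (sub N) (sub M) (image v)) where

    -- `bad` is the vertex whose step cannot be copied without the extra ā: μ in Ã and ν in Â.
    -- Whatever follows that step avoids it and is copied outright.
    sub-LDeriv : ∀ {us} {L : Labelling Y α} {L′ : Labelling Y β} → S.LDeriv L L′ us → All (bad ≢_) us →
      LDeriv (sub L) (sub L′) (concatMap image us)
    sub-LDeriv S.[] [] = []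
    sub-LDeriv (S.astep ξ ρ {L} M v k c d D) (b ∷ bs) = sub-plug ξ L (step ρ _ M v b k c d) ⨾ sub-LDeriv D bs
    sub-LDeriv (S.lstep ξ ρ {L} D) bs = sub-plug ξ L (sub-act ρ _) ⨾ sub-LDeriv D bs

  -- The surplus `P` leaves a disjunction by associativity and commutativity and a conjunction by a
  -- switch. No vertex is used, so the flow is unaffected.
  pull : ∀ ξ (L : Labelling Y (ξ ⟦ γ ⟧)) {M : Labelling Y δ} {P : Labelling (λ _ → Edge H) α} →
    LDeriv (sub (hole ξ L)) (sub M ∨ᴸ P) [] → LDeriv (sub L) (sub (plug ξ L M) ∨ᴸ P) []
  pull □ L D = D
  pull (ξ ∨◁ β) (L ∨ᴸ N) D = ∨-liftˡ (pull ξ L D) ▸ rule (∨-assoc _ _ _) ▸ ∨-liftʳ ∨-swap ▸ rule (∨-assoc⁻¹ _ _ _)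
  pull (α ▷∨ ξ) (N ∨ᴸ L) D = ∨-liftʳ (pull ξ L D) ▸ rule (∨-assoc⁻¹ _ _ _)
  pull (ξ ∧◁ β) (L ∧ᴸ N) D = ∧-liftˡ (pull ξ L D) ▸ ∧-swap ▸ rule (switch _ _ _) ▸ ∨-liftˡ ∧-swap
  pull (α ▷∧ ξ) (N ∧ᴸ L) D = ∧-liftʳ (pull ξ L D) ▸ rule (switch _ _ _)

  -- Dual to `pull`: `P` enters a disjunction by a switch and a conjunction by associativity.
  push : ∀ ξ (L : Labelling Y (ξ ⟦ γ ⟧)) {M : Labelling Y δ} {P : Labelling (λ _ → Edge H) α} →
    LDeriv (P ∧ᴸ sub (hole ξ L)) (sub M) [] → LDeriv (P ∧ᴸ sub L) (sub (plug ξ L M)) []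
  push □ L D = D
  push (ξ ∨◁ β) (L ∨ᴸ N) D = rule (switch _ _ _) ▸ ∨-liftˡ (push ξ L D)
  push (α ▷∨ ξ) (N ∨ᴸ L) D = ∧-liftʳ ∨-swap ▸ rule (switch _ _ _) ▸ ∨-liftˡ (push ξ L D) ▸ ∨-swap
  push (ξ ∧◁ β) (L ∧ᴸ N) D = rule (∧-assoc⁻¹ _ _ _) ▸ ∧-liftˡ (push ξ L D)
  push (α ▷∧ ξ) (N ∧ᴸ L) D = ∧-liftʳ ∧-swap ▸ rule (∧-assoc⁻¹ _ _ _) ▸ ∧-liftˡ (push ξ L D) ▸ ∧-swap

-- Lists of vertices without repetition

occList : ∀ {Y : Set} γ → (Occ γ → Y) → List Y
occList 𝖿 p = []
occList 𝗍 p = []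
occList (atom a) p = p here ∷ []
occList (γ ∨ δ) p = occList γ (p ∘ ∨ˡ) ++ occList δ (p ∘ ∨ʳ)
occList (γ ∧ δ) p = occList γ (p ∘ ∧ˡ) ++ occList δ (p ∘ ∧ʳ)

occList-All : ∀ {Y : Set} {P : Y → Set} γ {p : Occ γ → Y} → (∀ o → P (p o)) → All P (occList γ p)
occList-All 𝖿 q = []
occList-All 𝗍 q = []
occList-All (atom a) q = q here ∷ []
occList-All (γ ∨ δ) q = All.++⁺ (occList-All γ (q ∘ ∨ˡ)) (occList-All δ (q ∘ ∨ʳ))
occList-All (γ ∧ δ) q = All.++⁺ (occList-All γ (q ∘ ∧ˡ)) (occList-All δ (q ∘ ∧ʳ))

occList-∈⁻ : ∀ {Y : Set} γ {p : Occ γ → Y} {y} → y ∈ occList γ p → ∃ λ o → p o ≡ y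
occList-∈⁻ γ {p} = All.lookup (occList-All {P = λ y → ∃ λ o → p o ≡ y} γ (λ o → o , refl))

occList-∈ : ∀ {Y : Set} {γ} {p : Occ γ → Y} o → p o ∈ occList γ p
occList-∈ here = here refl
occList-∈ (∨ˡ o) = ∈-++⁺ˡ (occList-∈ o)
occList-∈ (∨ʳ o) = ∈-++⁺ʳ _ (occList-∈ o)
occList-∈ (∧ˡ o) = ∈-++⁺ˡ (occList-∈ o)
occList-∈ (∧ʳ o) = ∈-++⁺ʳ _ (occList-∈ o)

occList-Unique : ∀ {Y : Set} γ {p : Occ γ → Y} → (∀ o o′ → p o ≡ p o′ → o ≡ o′) → Unique (occList γ p)
occList-Unique 𝖿 inj = []
occList-Unique 𝗍 inj = []
occList-Unique (atom a) inj = [] ∷ []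
occList-Unique (γ ∨ δ) {p} inj = Unique.++⁺
  (occList-Unique γ λ o o′ eq → ∨ˡ-injective (inj _ _ eq)) (occList-Unique δ λ o o′ eq → ∨ʳ-injective (inj _ _ eq))
  λ (y∈ˡ , y∈ʳ) → ∨ˡ≢∨ʳ (occList-∈⁻ γ y∈ˡ) (occList-∈⁻ δ y∈ʳ)
  where
  ∨ˡ-injective : ∀ {o o′} → ∨ˡ {γ} {δ} o ≡ ∨ˡ o′ → o ≡ o′
  ∨ˡ-injective refl = refl
  ∨ʳ-injective : ∀ {o o′} → ∨ʳ {γ} {δ} o ≡ ∨ʳ o′ → o ≡ o′
  ∨ʳ-injective refl = refl
  ∨ˡ≢∨ʳ : ∀ {y} → (∃ λ o → p (∨ˡ o) ≡ y) → (∃ λ o → p (∨ʳ o) ≡ y) → ⊥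
  ∨ˡ≢∨ʳ (_ , eq) (_ , eq′) with inj _ _ (trans eq (sym eq′))
  ... | ()
occList-Unique (γ ∧ δ) {p} inj = Unique.++⁺
  (occList-Unique γ λ o o′ eq → ∧ˡ-injective (inj _ _ eq)) (occList-Unique δ λ o o′ eq → ∧ʳ-injective (inj _ _ eq))
  λ (y∈ˡ , y∈ʳ) → ∧ˡ≢∧ʳ (occList-∈⁻ γ y∈ˡ) (occList-∈⁻ δ y∈ʳ)
  where
  ∧ˡ-injective : ∀ {o o′} → ∧ˡ {γ} {δ} o ≡ ∧ˡ o′ → o ≡ o′
  ∧ˡ-injective refl = refl
  ∧ʳ-injective : ∀ {o o′} → ∧ʳ {γ} {δ} o ≡ ∧ʳ o′ → o ≡ o′
  ∧ʳ-injective refl = refl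
  ∧ˡ≢∧ʳ : ∀ {y} → (∃ λ o → p (∧ˡ o) ≡ y) → (∃ λ o → p (∧ʳ o) ≡ y) → ⊥
  ∧ˡ≢∧ʳ (_ , eq) (_ , eq′) with inj _ _ (trans eq (sym eq′))
  ... | ()

concatMap-Unique : ∀ {V W : Set} {f : V → List W} → (∀ v → Unique (f v)) →
  (∀ v w {y} → y ∈ f v → y ∈ f w → v ≡ w) → ∀ {vs} → Unique vs → Unique (concatMap f vs)
concatMap-Unique uniq inj u = Unique.concat⁺ (All.map⁺ (All.universal uniq _))
  (AllPairs.map⁺ (AllPairs.map (λ v≢w {_} (y∈v , y∈w) → v≢w (inj _ _ y∈v y∈w)) u))

concatMap-All : ∀ {V W : Set} {P : W → Set} {f : V → List W} → (∀ v → All P (f v)) → ∀ vs → All P (concatMap f vs)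
concatMap-All p vs = All.concat⁺ (All.map⁺ (All.universal p vs))

-- Assembling a derivation whose flow is the reduct

module Reduction {α β} (A : Graph (Occ α ⊎ ⊤) (Occ β ⊎ ⊤)) (κ : Edge (withSimpleEdge A) → Atom)
  (ε₂ : Edge A) (ε₂-src : src A ε₂ ≡ inj₁ (inj₂ tt)) (ε₂-unique : ∀ {e} → src A e ≡ inj₁ (inj₂ tt) → e ≡ ε₂)
  (ε₃ : Edge A) (ε₃-tgt : tgt A ε₃ ≡ inj₁ (inj₂ tt)) (ε₃-unique : ∀ {e} → tgt A e ≡ inj₁ (inj₂ tt) → e ≡ ε₃)
  (upper-uniqueᴬ : ∀ {e e′ i} → src A e ≡ inj₁ (inj₁ i) → src A e′ ≡ inj₁ (inj₁ i) → e ≡ e′) where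

  private
    G = withSimpleEdge A
    Y : Atom → Set
    Y = EdgeWithAtom G κ
    module S = LabelledDerivations G {Y} (λ _ → proj₁)

  open Inversion A
  open Reduct A ε₂ ε₂-src ε₂-unique ε₃ ε₃-tgt
  open LabelledDerivations H {λ _ → CEdge A} (λ _ → id)
  open DerivedRules H {λ _ → CEdge A} (λ _ → id)

  private
    complete˜ : ∀ {e v} → src H e ≡ inj₂ (copy˜ v) → ∃ λ e′ → e ≡ edge˜ e′ × src A e′ ≡ inj₂ v
    complete˜ eq with source-of eq
    ... | inner˜ p q = _ , p , q

    complete^ : ∀ {e v} → src H e ≡ inj₂ (copy^ v) → ∃ λ e′ → e ≡ edge^′ e′ × src A e′ ≡ inj₂ v
    complete^ eq with source-of eq
    ... | inner^ p q = _ , p , q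

    injective˜ : ∀ {e e′ v} → src A e ≡ inj₂ v → src A e′ ≡ inj₂ v → edge˜ {A = A} e ≡ edge˜ e′ → e ≡ e′
    injective˜ _ _ refl = refl

    injective^ : ∀ {e e′ v} → src A e ≡ inj₂ v → src A e′ ≡ inj₂ v → edge^′ e ≡ edge^′ e′ → e ≡ e′
    injective^ eq eq′ p with edge^′-inner eq | edge^′-inner eq′
    ... | _ , q | _ , q′ with trans (sym q) (trans p q′)
    ... | refl = refl

    module ~ = Substitution A H κ 𝗍 𝗍ᴸ edge˜ copy˜ (λ _ → refl) edge˜-tgt-inner edge˜-src-inner
      injective˜ complete˜
    module ^ = Substitution A H κ 𝖿 𝖿ᴸ edge^′ copy^ (λ _ → refl) edge^′-tgt-inner edge^′-src-inner
      injective^ complete^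

  b̄ : Atom
  b̄ = bar (κ (inj₂ tt))

  -- One occurrence for both ε̃₃ and ε̂₂; `edge˜ ε₃` is the name of the identified edge.
  P : Labelling (λ _ → CEdge A) (atom b̄)
  P = atomᴸ (edge˜ ε₃)

  -- Either side of the rule may carry ε₁. The recorded equation says that the partner edge carries
  -- the dual of the atom of ε₁, for ε₂ and ε₃ alike.
  data SimplePair (ε : Edge A) {a} : Y a → Y (bar a) → Set where
    left : ∀ {p q} → bar a ≡ b̄ → SimplePair ε (inj₂ tt , p) (inj₁ ε , q)
    right : ∀ {p q} → a ≡ b̄ → SimplePair ε (inj₁ ε , p) (inj₂ tt , q)

  -- The two labels differ, since their atoms are dual.
  simplePair : ∀ {ε a} (x : Y a) (y : Y (bar a)) →
    (∀ {e} → proj₁ x ≡ inj₁ e → e ≡ ε) → (∀ {e} → proj₁ y ≡ inj₁ e → e ≡ ε) → SimplePair ε x y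
  simplePair {a = a} (inj₂ tt , p) (inj₂ tt , q) _ _ = ⊥-elim (bar-≢ a (trans (sym p) q))
  simplePair {a = a} (inj₁ e , p) (inj₁ e′ , q) r s with r refl | s refl
  ... | refl | refl = ⊥-elim (bar-≢ a (trans (sym p) q))
  simplePair (inj₂ tt , p) (inj₁ e , q) _ s with s refl
  ... | refl = left (cong bar (sym p))
  simplePair {a = a} (inj₁ e , p) (inj₂ tt , q) r _ with r refl
  ... | refl = right (trans (sym (bar-involutive a)) (cong bar (sym q)))

  νPair : ∀ {a} (x : Y a) (y : Y (bar a)) → S.Creates (atomᴸ x ∨ᴸ atomᴸ y) (inj₂ ν) → SimplePair ε₂ x y
  νPair x y d = simplePair x y
    (λ { refl → ε₂-unique (src-ν (S.source d (∨ˡ here))) }) (λ { refl → ε₂-unique (src-ν (S.source d (∨ʳ here))) })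

  μPair : ∀ {a} (x : Y a) (y : Y (bar a)) → S.Consumes (atomᴸ x ∧ᴸ atomᴸ y) (inj₂ μ) → SimplePair ε₃ x y
  μPair x y c = simplePair x y
    (λ { refl → ε₃-unique (tgt-μ (c (∧ˡ here))) }) (λ { refl → ε₃-unique (tgt-μ (c (∧ʳ here))) })

  weaken : ∀ {a} → LDeriv 𝗍ᴸ (𝗍ᴸ ∨ᴸ atomᴸ {a = a} (edge˜ ε₂)) (newW ∷ [])
  weaken = rule (∨-unit⁻¹ 𝗍) ⨾ astep (𝗍 ▷∨ □) (aw↓ _) _ newW refl (λ ())
    (Creates-one (edge˜-src-slot ε₂-src) (λ e eq → only (source-of eq))) []
    where
    only : ∀ {e} → Source e (inj₂ newW) → edge˜ ε₂ ≡ e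
    only (slot˜ eq) = sym eq

  coweaken : ∀ {a} → LDeriv (atomᴸ {a = a} (edge^′ ε₃) ∧ᴸ 𝖿ᴸ) 𝖿ᴸ (newCoW ∷ [])
  coweaken = astep (□ ∧◁ 𝖿) (aw↑ _) 𝗍ᴸ newCoW refl (λ { here → edge^′-tgt-slot ε₃-tgt })
    (Creates-none (λ ()) (λ e eq → none (source-of {e} eq))) (∧-swap ▸ rule (∧-unit 𝖿))
    where
    none : ∀ {e} → Source e (inj₂ newCoW) → ⊥
    none ()

  release : ∀ {a} → a ≡ b̄ → LDeriv (atomᴸ {a = a} (edge˜ ε₃)) (𝖿ᴸ ∨ᴸ P) []
  release refl = rule (∨-unit⁻¹ _) ▸ ∨-swap

  -- The gluing takes effect here: `edge^′ ε₂` is `edge˜ ε₃`, so the occurrence set free at μ in one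
  -- copy is the one required at ν in the other.
  absorb : ∀ {a} → a ≡ b̄ → LDeriv (P ∧ᴸ 𝗍ᴸ) (atomᴸ {a = a} (edge^′ ε₂)) []
  absorb refl = subst (λ e → LDeriv (P ∧ᴸ 𝗍ᴸ) (atomᴸ e) []) (sym edge^′-slot) (rule (∧-unit _))

  -- Each of ν and μ leaves a vertex in one copy only; in the other copy its step becomes linear.
  image˜ image^ : Vtx G → List (Vtx H)
  image˜ (inj₁ v) = copy˜ v ∷ []
  image˜ (inj₂ ν) = newW ∷ []
  image˜ (inj₂ μ) = []
  image^ (inj₁ v) = copy^ v ∷ []
  image^ (inj₂ ν) = []
  image^ (inj₂ μ) = newCoW ∷ []

  step˜ : ∀ {γ δ k} (ρ : ARule k γ δ) (N : Labelling Y γ) (M : Labelling Y δ) v → inj₂ μ ≢ v → kind G v ≡ k →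
    S.Consumes N v → S.Creates M v → LDeriv (~.sub N) (~.sub M) (image˜ v)
  step˜ ρ N M (inj₁ v) _ k c d = ~.sub-arule ρ N M k c d
  step˜ ρ N M (inj₂ μ) b _ _ _ = ⊥-elim (b refl)
  step˜ (ai↓ a) 𝗍ᴸ (atomᴸ x ∨ᴸ atomᴸ y) (inj₂ ν) _ refl c d with νPair x y d
  ... | left _ = weaken
  ... | right _ = weaken ▸ ∨-swap

  step^ : ∀ {γ δ k} (ρ : ARule k γ δ) (N : Labelling Y γ) (M : Labelling Y δ) v → inj₂ ν ≢ v → kind G v ≡ k →
    S.Consumes N v → S.Creates M v → LDeriv (^.sub N) (^.sub M) (image^ v)
  step^ ρ N M (inj₁ v) _ k c d = ^.sub-arule ρ N M k c d
  step^ ρ N M (inj₂ ν) b _ _ _ = ⊥-elim (b refl)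
  step^ (ai↑ a) (atomᴸ x ∧ᴸ atomᴸ y) 𝖿ᴸ (inj₂ μ) _ refl c d with μPair x y c
  ... | left _ = ∧-swap ⨾ coweaken
  ... | right _ = coweaken

  release-μ : ∀ {γ δ k} (ρ : ARule k γ δ) (N : Labelling Y γ) (M : Labelling Y δ) → cointeraction ≡ k →
    S.Consumes N (inj₂ μ) → LDeriv (~.sub N) (~.sub M ∨ᴸ P) []
  release-μ (ai↑ a) (atomᴸ x ∧ᴸ atomᴸ y) 𝖿ᴸ refl c with μPair x y c
  ... | left eq = ∧-swap ▸ rule (∧-unit _) ▸ release eq
  ... | right eq = rule (∧-unit _) ▸ release eq

  absorb-ν : ∀ {γ δ k} (ρ : ARule k γ δ) (N : Labelling Y γ) (M : Labelling Y δ) → interaction ≡ k →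
    S.Creates M (inj₂ ν) → LDeriv (P ∧ᴸ ^.sub N) (^.sub M) []
  absorb-ν (ai↓ a) 𝗍ᴸ (atomᴸ x ∨ᴸ atomᴸ y) refl d with νPair x y d
  ... | left eq = absorb eq ▸ rule (∨-unit⁻¹ _) ▸ ∨-swap
  ... | right eq = absorb eq ▸ rule (∨-unit⁻¹ _)

  -- At μ the atom `P` is set free, and from there on it stays outside as a disjunct. As μ does not
  -- recur, `sub-LDeriv` copies the tail.
  copy-releasing : ∀ {us} {L : Labelling Y γ} {L′ : Labelling Y δ} → S.LDeriv L L′ us → inj₂ μ ∈ us → Unique us →
    LDeriv (~.sub L) (~.sub L′ ∨ᴸ P) (concatMap image˜ us)
  copy-releasing (S.astep ξ ρ {L} M (inj₂ μ) k c d D) _ (fresh ∷ _) =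
    ~.pull ξ L (release-μ ρ _ M k c) ⨾ ∨-liftˡ (~.sub-LDeriv (inj₂ μ) image˜ step˜ D fresh)
  copy-releasing (S.astep ξ ρ {L} M v@(inj₂ ν) k c d D) (there m) (_ ∷ u) =
    ~.sub-plug ξ L (step˜ ρ _ M v (λ ()) k c d) ⨾ copy-releasing D m u
  copy-releasing (S.astep ξ ρ {L} M v@(inj₁ _) k c d D) (there m) (_ ∷ u) =
    ~.sub-plug ξ L (step˜ ρ _ M v (λ ()) k c d) ⨾ copy-releasing D m u
  copy-releasing (S.lstep ξ ρ {L} D) m u = ~.sub-plug ξ L (~.sub-act ρ _) ⨾ copy-releasing D m u

  -- `P` waits outside as a conjunct until ν, where it supplies the atom that the interaction would
  -- have created on ε₂.
  copy-absorbing : ∀ {us} {L : Labelling Y γ} {L′ : Labelling Y δ} → S.LDeriv L L′ us → inj₂ ν ∈ us → Unique us →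
    LDeriv (P ∧ᴸ ^.sub L) (^.sub L′) (concatMap image^ us)
  copy-absorbing (S.astep ξ ρ {L} M (inj₂ ν) k c d D) _ (fresh ∷ _) =
    ^.push ξ L (absorb-ν ρ _ M k d) ⨾ ^.sub-LDeriv (inj₂ ν) image^ step^ D fresh
  copy-absorbing (S.astep ξ ρ {L} M v@(inj₂ μ) k c d D) (there m) (_ ∷ u) =
    ∧-liftʳ (^.sub-plug ξ L (step^ ρ _ M v (λ ()) k c d)) ⨾ copy-absorbing D m u
  copy-absorbing (S.astep ξ ρ {L} M v@(inj₁ _) k c d D) (there m) (_ ∷ u) =
    ∧-liftʳ (^.sub-plug ξ L (step^ ρ _ M v (λ ()) k c d)) ⨾ copy-absorbing D m u
  copy-absorbing (S.lstep ξ ρ {L} D) m u = ∧-liftʳ (^.sub-plug ξ L (^.sub-act ρ _)) ⨾ copy-absorbing D m u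

  -- `e` is the only edge of `A` starting at `i`, and its two copies are distinct: it does not start
  -- at the slot of ε₂, so its copy in Â is a genuine `edge^`.
  cocontract-Creates : ∀ {e i a} → src A e ≡ inj₁ (inj₁ i) →
    Creates (atomᴸ {a = a} (edge˜ e) ∧ᴸ atomᴸ (edge^′ e)) (coctr i)
  cocontract-Creates {e} {i} {a} eq = creates
    (λ { (∧ˡ here) → edge˜-src-upper eq ; (∧ʳ here) → edge^′-src-upper eq })
    (λ { (∧ˡ here) (∧ˡ here) _ → refl ; (∧ʳ here) (∧ʳ here) _ → refl
       ; (∧ˡ here) (∧ʳ here) p → ⊥-elim (edge˜≢ p) ; (∧ʳ here) (∧ˡ here) p → ⊥-elim (edge˜≢ (sym p)) })
    (λ e′ eq′ → only (source-of eq′))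
    where
    edge˜≢ : edge˜ e ≢ edge^′ e
    edge˜≢ p with trans p (edge^′-nonslot (subst NotSlot (sym eq) tt))
    ... | ()
    only : ∀ {e′} → Source e′ (inj₂ (coctr i)) → ∃ λ o → (atomᴸ {a = a} (edge˜ e) ∧ᴸ atomᴸ {a = a} (edge^′ e)) ! o ≡ e′
    only (upper˜ refl q) = ∧ˡ here , cong edge˜ (upper-uniqueᴬ eq q)
    only (upper^ refl q) = ∧ʳ here , cong edge^′ (upper-uniqueᴬ eq q)

  -- Duplication reduces to atoms: medial regroups the copies of a disjunction, `∧-exchange` those
  -- of a conjunction. No premiss label is ε₁, so the substituted formulae are copies of `γ`;
  -- deriving into them directly avoids a transport along that fact.
  cocontract : (L : Labelling Y γ) (h : Occ γ → Occ α) → (∀ o → src G (L S.! o) ≡ inj₁ (h o)) →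
    LDeriv (tabulate (upE ∘ h)) (~.sub L ∧ᴸ ^.sub L) (occList γ (coctr ∘ h))
  cocontract 𝖿ᴸ h _ = rule 𝖿∧𝖿⁻¹
  cocontract 𝗍ᴸ h _ = rule (∧-unit⁻¹ 𝗍)
  cocontract (atomᴸ (inj₁ e , _)) h up = astep □ (ac↑ _) _ (coctr (h here)) refl (λ { here → refl })
    (cocontract-Creates (src-upper (up here))) []
  cocontract (atomᴸ (inj₂ _ , _)) h up with up here
  ... | ()
  cocontract (L ∨ᴸ N) h up =
    ∨-liftˡ (cocontract L (h ∘ ∨ˡ) (up ∘ ∨ˡ)) ⨾ (∨-liftʳ (cocontract N (h ∘ ∨ʳ) (up ∘ ∨ʳ)) ▸ rule (medial _ _ _ _))
  cocontract (L ∧ᴸ N) h up =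
    ∧-liftˡ (cocontract L (h ∘ ∧ˡ) (up ∘ ∧ˡ)) ⨾ (∧-liftʳ (cocontract N (h ∘ ∧ʳ) (up ∘ ∧ʳ)) ▸ ∧-exchange)

  -- Dual to `cocontract`, with medial now serving conjunctions.
  contract : (L : Labelling Y γ) (h : Occ γ → Occ β) → (∀ o → tgt G (L S.! o) ≡ inj₁ (h o)) →
    LDeriv (~.sub L ∨ᴸ ^.sub L) (tabulate (lowE ∘ h)) (occList γ (ctr ∘ h))
  contract 𝖿ᴸ h _ = rule (∨-unit 𝖿)
  contract 𝗍ᴸ h _ = rule 𝗍∨𝗍
  contract (atomᴸ (inj₁ e , _)) h low = astep □ (ac↓ _) _ (ctr (h here)) refl
    (λ { (∨ˡ here) → edge˜-tgt-lower (tgt-lower (low here)) ; (∨ʳ here) → edge^′-tgt-lower (tgt-lower (low here)) })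
    (Creates-one refl (λ e′ eq → only (source-of eq))) []
    where
    only : ∀ {e′ j} → Source e′ (inj₂ (ctr j)) → lowE j ≡ e′
    only (lower refl) = refl
  contract (atomᴸ (inj₂ _ , _)) h low with low here
  ... | ()
  contract (L ∨ᴸ N) h low =
    ∨-exchange ⨾ ∨-liftˡ (contract L (h ∘ ∨ˡ) (low ∘ ∨ˡ)) ⨾ ∨-liftʳ (contract N (h ∘ ∨ʳ) (low ∘ ∨ʳ))
  contract (L ∧ᴸ N) h low =
    rule (medial _ _ _ _) ⨾ ∧-liftˡ (contract L (h ∘ ∧ˡ) (low ∘ ∧ˡ)) ⨾ ∧-liftʳ (contract N (h ∘ ∧ʳ) (low ∘ ∧ʳ))

  reduced-vertices : List (Vtx G) → List (Vtx H)
  reduced-vertices us = occList α coctr ++ concatMap image˜ us ++ concatMap image^ us ++ occList β ctr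

  reduced : ∀ {us} {L : Labelling Y α} {L′ : Labelling Y β} → S.LDeriv L L′ us → Unique us → (∀ v → v ∈ us) →
    (∀ o → src G (L S.! o) ≡ inj₁ o) → (∀ o → tgt G (L′ S.! o) ≡ inj₁ o) →
    LDeriv (tabulate upE) (tabulate lowE) (reduced-vertices us)
  reduced {L = L} {L′} D u total up low =
    cocontract L id up ⨾ (∧-liftˡ (copy-releasing D (total _) u) ▸ switchʳ) ⨾
    ∨-liftʳ (copy-absorbing D (total _) u) ⨾ contract L′ id low

  -- Numbers the four blocks of `reduced-vertices`, so that their disjointness becomes an inequality
  -- of numbers.
  part : Vtx H → ℕ
  part (coctr _) = 0
  part (copy˜ _) = 1
  part newW = 1
  part (copy^ _) = 2
  part newCoW = 2
  part (ctr _) = 3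

  append-Unique : ∀ {n xs ys} → All (λ v → part v ≡ n) xs → All (λ v → n < part v) ys →
    Unique xs → Unique ys → Unique (xs ++ ys)
  append-Unique p q u w = Unique.++⁺ u w λ (v∈xs , v∈ys) → <-irrefl (sym (All.lookup p v∈xs)) (All.lookup q v∈ys)

  reduced-Unique : ∀ {us} → Unique us → Unique (reduced-vertices us)
  reduced-Unique {us} u =
    append-Unique upper-part (All.++⁺ (above 0<1+n copy˜-part) (All.++⁺ (above 0<1+n copy^-part) (above 0<1+n lower-part)))
      (occList-Unique α λ { _ _ refl → refl })
      (append-Unique copy˜-part (All.++⁺ (above (s<s 0<1+n) copy^-part) (above (s<s 0<1+n) lower-part))
        (concatMap-Unique unique˜ image˜-injective u)
        (append-Unique copy^-part (above (s<s (s<s 0<1+n)) lower-part)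
          (concatMap-Unique unique^ image^-injective u)
          (occList-Unique β λ { _ _ refl → refl })))
    where
    above : ∀ {m n xs} → m < n → All (λ v → part v ≡ n) xs → All (λ v → m < part v) xs
    above m<n = All.map λ eq → subst (_ <_) (sym eq) m<n

    upper-part = occList-All {P = λ v → part v ≡ 0} α {coctr} (λ _ → refl)
    lower-part = occList-All {P = λ v → part v ≡ 3} β {ctr} (λ _ → refl)

    copy˜-part : All (λ v → part v ≡ 1) (concatMap image˜ us)
    copy˜-part = concatMap-All (λ { (inj₁ _) → refl ∷ [] ; (inj₂ ν) → refl ∷ [] ; (inj₂ μ) → [] }) us

    copy^-part : All (λ v → part v ≡ 2) (concatMap image^ us)
    copy^-part = concatMap-All (λ { (inj₁ _) → refl ∷ [] ; (inj₂ μ) → refl ∷ [] ; (inj₂ ν) → [] }) us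

    unique˜ : ∀ v → Unique (image˜ v)
    unique˜ (inj₁ _) = [] ∷ []
    unique˜ (inj₂ ν) = [] ∷ []
    unique˜ (inj₂ μ) = []

    unique^ : ∀ v → Unique (image^ v)
    unique^ (inj₁ _) = [] ∷ []
    unique^ (inj₂ ν) = []
    unique^ (inj₂ μ) = [] ∷ []

    image˜-injective : ∀ v w {y} → y ∈ image˜ v → y ∈ image˜ w → v ≡ w
    image˜-injective (inj₁ _) (inj₁ _) (here refl) (here refl) = refl
    image˜-injective (inj₁ _) (inj₂ ν) (here refl) (here ())
    image˜-injective (inj₂ ν) (inj₁ _) (here refl) (here ())
    image˜-injective (inj₂ ν) (inj₂ ν) _ _ = refl

    image^-injective : ∀ v w {y} → y ∈ image^ v → y ∈ image^ w → v ≡ w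
    image^-injective (inj₁ _) (inj₁ _) (here refl) (here refl) = refl
    image^-injective (inj₁ _) (inj₂ μ) (here refl) (here ())
    image^-injective (inj₂ μ) (inj₁ _) (here refl) (here ())
    image^-injective (inj₂ μ) (inj₂ μ) _ _ = refl

  reduced-total : ∀ {us} → (∀ v → v ∈ us) → ∀ v → v ∈ reduced-vertices us
  reduced-total {us} total = λ where
      (coctr i) → ∈-++⁺ˡ (occList-∈ i)
      (copy˜ v) → in˜ (inj₁ v) (here refl)
      newW → in˜ (inj₂ ν) (here refl)
      (copy^ v) → in^ (inj₁ v) (here refl)
      newCoW → in^ (inj₂ μ) (here refl)
      (ctr j) → ∈-++⁺ʳ (occList α coctr) (∈-++⁺ʳ (concatMap image˜ us) (∈-++⁺ʳ (concatMap image^ us) (occList-∈ j)))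
    where
    in˜ : ∀ v {w} → w ∈ image˜ v → w ∈ reduced-vertices us
    in˜ v w∈ = ∈-++⁺ʳ (occList α coctr) (∈-++⁺ˡ (∈-concatMap⁺ image˜ (lose (total v) w∈)))
    in^ : ∀ v {w} → w ∈ image^ v → w ∈ reduced-vertices us
    in^ v w∈ = ∈-++⁺ʳ (occList α coctr)
      (∈-++⁺ʳ (concatMap image˜ us) (∈-++⁺ˡ (∈-concatMap⁺ image^ (lose (total v) w∈))))

  realised : ∀ {us} {L : Labelling Y α} {L′ : Labelling Y β} → S.LDeriv L L′ us → Unique us → (∀ v → v ∈ us) →
    (∀ o → src G (L S.! o) ≡ inj₁ o) → (∀ o → tgt G (L′ S.! o) ≡ inj₁ o) →
    Σ (Deriv α β) (λ Ψ → flowOf Ψ ≅ H)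
  realised D u total up low = erase Ψ , flowOf-erase H (λ _ → id) Ψ
    (λ o → cong (src H) (tabulate-! upE o)) (λ e o eq → trans (tabulate-! upE o) (only (source-of eq)))
    (λ o → cong (tgt H) (tabulate-! lowE o)) (reduced-Unique u) (reduced-total total)
    where
    Ψ = reduced D u total up low
    only : ∀ {e o} → Source e (inj₁ o) → upE o ≡ e
    only (upper refl) = refl

theorem5p3 : ∀ {α β : Formula} (B C : Graph (Occ α) (Occ β)) →
    IsAtomicFlow B → IsAtomicFlow C → B →se C →
    (Φ : Deriv α β) → flowOf Φ ≅ B →
    Σ (Deriv α β) (λ Ψ → flowOf Ψ ≅ C)
theorem5p3 B C B-flow _ B→C Φ Φ≅B
  with labelled (withSimpleEdge (_→se_.A B→C)) Φ (≅-trans Φ≅B (_→se_.B≅ B→C))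
     | other-lower B-flow (_→se_.B≅ B→C) (inj₂ ν) refl (inj₂ tt) refl
     -- The reduction names ε₂ but not ε₃, which is found here as the upper edge of μ other than ε₁.
     | other-upper B-flow (_→se_.B≅ B→C) (inj₂ μ) refl (inj₂ tt) refl
... | κ , L , L′ , us , D , up , low , unique , total | low-ν | inj₂ tt , _ , ≢ε₁ , _ = ⊥-elim (≢ε₁ refl)
... | κ , L , L′ , us , D , up , low , unique , total | _ , _ , _ , ε₂-only | inj₁ ε₃ , ε₃-tgt , _ , ε₃-only =
  let Ψ , Ψ≅ = realised D unique total up low in Ψ , ≅-trans Ψ≅ (≅-sym C≅)
  where
  open _→se_ B→C
  open Inversion A
  open Reduction A κ ε₂ ε₂-src
    -- Both edges leave ν and differ from ε₁, hence both equal its unique partner there.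
    (λ eq → inj₁-injective (trans (ε₂-only _ (src-ν⁺ eq) (λ ())) (sym (ε₂-only _ (src-ν⁺ ε₂-src) (λ ())))))
    ε₃ (tgt-μ ε₃-tgt) (λ eq → inj₁-injective (ε₃-only _ (tgt-μ⁺ eq) (λ ())))
    (λ p q → inj₁-injective (upper-unique B-flow B≅ _ _ (src-upper⁺ p) (src-upper⁺ q)))
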